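{- Let $Q=[n]^{(\geq n/2)}$ with the partial order $<$ defined below. Then $(Q,<)$ is a graded poset whose levels are $[n]^{(k)}$ for $\lceil n/2\rceil\leq k\leq n$, and $(Q,<)$ is a normalized matching poset.
   Context: For $x\subseteq[n]$ and integers $1\le i\le j\le n$ let $c_x(i,j)=|x\cap[i,j]|-|[i,j]\setminus x|$, where $[i,j]=\{i,\dots,j\}$. The signature $sg(x)\in\{0,1,*\}^n$ is defined as follows: if $i\in x$ and there is $j$ with $i<j\leq n$ and $c_x(i,j)=0$, then $sg(x)_i=1$, otherwise ($i\in x$) $sg(x)_i=*$; if $i\notin x$ and there is $j$ with $1\leq j<i$ and $c_x(j,i)=0$, then $sg(x)_i=0$, otherwise ($i\notin x$) $sg(x)_i=*$. Let $x\sim y$ iff $sg(x)=sg(y)$; each equivalence class is a symmetric chain in $2^{[n]}$ (a chain $c_0\subset\cdots\subset c_k$ with $|c_i|=(n-k)/2+i$). For $x\in Q$, let $p(x)$ be the unique element of the $\sim$-class of $x$ with $|x|+|p(x)|=n$. For $x,y\in Q$ define $y<x$ iff $y\neq x$ and $p(x)\subseteq p(y)\subseteq y\subseteq x$. A graded poset is a normalized matching poset if for any two distinct levels $A_i,A_j$, the bipartite comparability graph $G$ between them is a normalized matching graph: $|X|/|A_i|\le|\Gamma(X)|/|A_j|$ for every $X\subseteq A_i$, $\Gamma(X)$ being the neighbourhood of $X$. -}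

module Defs where

open import Data.Bool using (Bool; true; false; if_then_else_; _∧_; not)
open import Data.Nat using (ℕ; zero; suc; _+_; _*_; _≤_; _<_; ⌈_/2⌉)
import Data.Nat as N
open import Data.Integer as Z using (ℤ; +_; -[1+_])
open import Data.Fin using (Fin; toℕ)
open import Data.Fin.Subset using (Subset; _⊆_; ∣_∣; inside; outside)
open import Data.Fin.Subset.Properties using (_⊆?_)
open import Data.Vec using (Vec; []; _∷_; lookup)
open import Data.Vec.Properties using (≡-dec)
import Data.Bool.Properties as BP
open import Data.List as L using (List; []; _∷_; allFin; filterᵇ; length)
open import Data.Bool.ListAction using (any)
open import Data.Product using (_×_; Σ; _,_)
open import Relation.Nullary using (¬_; Dec; yes; no)
open import Relation.Nullary.Decidable using (⌊_⌋; _×-dec_; ¬?)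
open import Relation.Binary.PropositionalEquality using (_≡_; _≢_)

-- all subsets of [n] (as characteristic vectors; index i : Fin n stands for i+1)
allSubsets : (n : ℕ) → List (Subset n)
allSubsets zero    = [] ∷ []
allSubsets (suc n) = L.map (outside ∷_) (allSubsets n) L.++ L.map (inside ∷_) (allSubsets n)

count : {n : ℕ} → (Subset n → Bool) → ℕ
count {n} X = length (filterᵇ X (allSubsets n))

-- c_x(i,j) = |x ∩ [i,j]| - |[i,j] \ x|
c : {n : ℕ} → Subset n → Fin n → Fin n → ℤ
c {n} x i j = L.foldr Z._+_ (+ 0)
  (L.map (λ k → if lookup x k then + 1 else -[1+ 0 ])
     (filterᵇ (λ k → ⌊ toℕ i N.≤? toℕ k ⌋ ∧ ⌊ toℕ k N.≤? toℕ j ⌋) (allFin n)))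

data Sym : Set where
  s0 s1 s* : Sym

sgAt : {n : ℕ} → Subset n → Fin n → Sym
sgAt {n} x i with lookup x i
... | true  = if any (λ j → ⌊ toℕ i N.<? toℕ j ⌋ ∧ ⌊ c x i j Z.≟ + 0 ⌋) (allFin n) then s1 else s*
... | false = if any (λ j → ⌊ toℕ j N.<? toℕ i ⌋ ∧ ⌊ c x j i Z.≟ + 0 ⌋) (allFin n) then s0 else s*

sg : {n : ℕ} → Subset n → Vec Sym n
sg {n} x = Data.Vec.tabulate (sgAt x)

_≟S_ : (a b : Sym) → Dec (a ≡ b)
s0 ≟S s0 = yes Relation.Binary.PropositionalEquality.refl
s1 ≟S s1 = yes Relation.Binary.PropositionalEquality.refl
s* ≟S s* = yes Relation.Binary.PropositionalEquality.refl
s0 ≟S s1 = no λ ()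
s0 ≟S s* = no λ ()
s1 ≟S s0 = no λ ()
s1 ≟S s* = no λ ()
s* ≟S s0 = no λ ()
s* ≟S s1 = no λ ()

_∼_ : {n : ℕ} → Subset n → Subset n → Set
x ∼ y = sg x ≡ sg y

-- p(x): the (unique) element z of the ∼-class of x with |x| + |z| = n,
-- found by search over all subsets (default x, never used since it exists)
pSearch : {n : ℕ} → Subset n → List (Subset n) → Subset n
pSearch x [] = x
pSearch {n} x (z ∷ zs) =
  if ⌊ ≡-dec _≟S_ (sg z) (sg x) ⌋ ∧ ⌊ ∣ x ∣ N.+ ∣ z ∣ N.≟ n ⌋ then z else pSearch x zs

p : {n : ℕ} → Subset n → Subset n
p {n} x = pSearch x (allSubsets n)

InQ : {n : ℕ} → Subset n → Set
InQ {n} x = n ≤ 2 * ∣ x ∣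

_≺_ : {n : ℕ} → Subset n → Subset n → Set
y ≺ x = y ≢ x × p x ⊆ p y × p y ⊆ y × y ⊆ x

_≺?_ : {n : ℕ} → (y x : Subset n) → Dec (y ≺ x)
y ≺? x = ¬? (≡-dec BP._≟_ y x) ×-dec (p x ⊆? p y) ×-dec (p y ⊆? y) ×-dec (y ⊆? x)

comparableᵇ : {n : ℕ} → Subset n → Subset n → Bool
comparableᵇ x y = ⌊ x ≺? y ⌋ Data.Bool.∨ ⌊ y ≺? x ⌋

level : {n : ℕ} → ℕ → Subset n → Bool
level k x = ⌊ ∣ x ∣ N.≟ k ⌋

Γ : {n : ℕ} → (Subset n → Bool) → ℕ → Subset n → Bool
Γ {n} X l y = level l y ∧ any (λ x → X x ∧ comparableᵇ x y) (allSubsets n)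

-- (Q,≺) is a graded poset with levels [n]^(k), ⌈n/2⌉ ≤ k ≤ n, i.e. with rank
-- function |x| - ⌈n/2⌉: strict partial order on Q, covering pairs increase the
-- size by one, minimal elements have size ⌈n/2⌉.
IsGradedWithSizeLevels : ℕ → Set
IsGradedWithSizeLevels n =
  (∀ (x : Subset n) → InQ x → ¬ (x ≺ x)) ×
  (∀ (x y z : Subset n) → InQ x → InQ y → InQ z → x ≺ y → y ≺ z → x ≺ z) ×
  (∀ (x y : Subset n) → InQ x → InQ y → y ≺ x →
     (∀ (z : Subset n) → InQ z → ¬ (y ≺ z × z ≺ x)) → ∣ x ∣ ≡ suc ∣ y ∣) ×
  (∀ (x : Subset n) → InQ x → (∀ (y : Subset n) → InQ y → ¬ (y ≺ x)) → ∣ x ∣ ≡ ⌈ n /2⌉)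

-- normalized matching between any two distinct levels [n]^(k), [n]^(l):
-- |X| / |A_k| ≤ |Γ(X)| / |A_l|, written cross-multiplied
IsNormalizedMatching : ℕ → Set
IsNormalizedMatching n =
  ∀ (k l : ℕ) → ⌈ n /2⌉ ≤ k → k ≤ n → ⌈ n /2⌉ ≤ l → l ≤ n → k ≢ l →
  ∀ (X : Subset n → Bool) → (∀ x → X x ≡ true → ∣ x ∣ ≡ k) →
  count X * count (level {n} l) ≤ count (Γ X l) * count (level {n} k)

{-# OPTIONS --safe #-}

-- Read x cyclically and call an element of x free if every cyclic window starting at it has more
-- ones than zeros. There are 2|x| − n free elements; removing them from x changes no entry of the
-- signature, so p(x) is x without its free elements. As freeness of an element is inherited by
-- supersets, y ≼ x in Q just says p(x) ⊆ y ⊆ x.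
--
-- For the matching property between [n]^(k) and [n]^(k+1), give each y one token for each index that
-- is not a free element of y, 2(n − k) in all. A token at t is moved to x = y ∪ {a}, where a is the
-- first index from t on after which no window of y has a negative balance; then y ≺ x. Each x
-- receives at most one token per index and one per free element, n + (2(k+1) − n) = 2(k + 1) in all,
-- so |X| (n − k) ≤ |Γ(X)| (k + 1). Composing levels gives all upward pairs, complements the downward.
module Submission where

open import Defs
open import Data.Bool using (Bool; true; false; not; _∧_; _∨_; if_then_else_; T; T?)
import Data.Bool.Properties as Bool
open import Data.Bool.ListAction using (any)
open import Data.Bool.Properties using (¬-not)
open import Data.Empty using (⊥; ⊥-elim)
open import Data.Fin using (Fin; toℕ; fromℕ<; zero; suc)
open import Data.Fin.Properties using (toℕ<n; toℕ-fromℕ<; toℕ-injective; any?)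
open import Data.Fin.Subset using (Subset; ∣_∣; _⊆_; _∈_)
open import Data.Fin.Subset.Properties using (⊆-antisym; ⊆-trans; p⊆q⇒∣p∣≤∣q∣; p⊂q⇒∣p∣<∣q∣)
open import Data.Integer as ℤ using (ℤ; -[1+_]; _⊖_)
import Data.Integer.Properties as ℤ
import Data.List as L
open L using (List; length; filterᵇ; allFin; upTo; applyUpTo; cartesianProduct)
open import Data.List.Membership.Propositional using (lose) renaming (_∈_ to _∈ˡ_)
open import Data.List.Membership.Propositional.Properties using (∈-allFin; ∈-++⁺ˡ; ∈-++⁺ʳ; ∈-++⁻; ∈-map⁺; ∈-map⁻; ∈-filter⁺; ∈-filter⁻; ∈-cartesianProduct⁺; ∈-cartesianProduct⁻; ∈-upTo⁺; ∈-upTo⁻; ∈-∃++)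
open import Data.List.Properties using (length-++; filter-++; length-++-sucʳ; length-upTo)
open import Data.List.Relation.Unary.All as All using ()
open import Data.List.Relation.Unary.AllPairs using ([]; _∷_)
open import Data.List.Relation.Unary.Any using (here; there; satisfied)
open import Data.List.Relation.Unary.Any.Properties using (any⁺; any⁻)
open import Data.List.Relation.Unary.Unique.Propositional using (Unique)
open import Data.List.Relation.Unary.Unique.Propositional.Properties using (cartesianProduct⁺; filter⁺; upTo⁺; map⁺; ++⁺)
open import Data.Nat
open import Data.Nat.DivMod using (_mod_; _%_; _/_; m<n⇒m%n≡m; [m+n]%n≡m%n; [m+kn]%n≡m%n; m%n<n; m≡m%n+[m/n]*n)
open import Data.Nat.Properties
open import Data.Nat.Tactic.RingSolver using (solve-∀)
open import Data.Product using (_×_; _,_; ∃; proj₁; proj₂)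
open import Data.Sum using (_⊎_; inj₁; inj₂; swap)
open import Data.Vec using ([]; _∷_; lookup; tabulate; _[_]≔_; head; tail)
open import Data.Vec.Properties using (lookup∘tabulate; tabulate-cong; []=⇒lookup; lookup⇒[]=; lookup∘update; lookup∘update′; ≡-dec)
open import Function using (_∘_)
open import Relation.Binary.Definitions using (tri<; tri≈; tri>)
open import Relation.Binary.PropositionalEquality
open import Relation.Nullary using (¬_; Dec; yes; no; contradiction)
open import Relation.Nullary.Decidable using (⌊_⌋; _×-dec_)
open import Relation.Unary using (Decidable)

-- The signature is defined on the line, freeness on the circle, and the two have to be reconciled.
-- Read ones as opening and zeros as closing brackets. The stars of the signature are the brackets
-- unmatched on the line, and there all zeros precede all ones. Closing the line into a circle
-- matches every starred zero with one of the last starred ones, so the free elements are the first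
-- 2|x| - n starred ones. Turning these into zeros leaves the starred zeros before the starred ones,
-- which is why no entry of the signature changes. In terms of heights, starred ones are last
-- passages, and the free ones are those at the lowest 2|x| - n heights from the minimum on.
--
-- The delicate point of the token argument is injectivity. In x = y ∪ {a} the element a is free and
-- no free element lies strictly between t and a, so t determines a whenever t is not free in x. If
-- t is free in x, then a could be t itself or the next free element. The second slot at each free
-- element exists to separate these two cases.

-- Windows and heights of Boolean sequences.

Seq : Set
Seq = ℕ → Bool

bit : Bool → ℕ
bit true  = 1
bit false = 0

ones : Seq → ℕ → ℕ → ℕ
ones s i zero    = 0
ones s i (suc ℓ) = bit (s i) + ones s (suc i) ℓ

zeros : Seq → ℕ → ℕ → ℕ
zeros s = ones (not ∘ s)

ones-+ : ∀ s i k ℓ → ones s i (k + ℓ) ≡ ones s i k + ones s (i + k) ℓ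
ones-+ s i zero    ℓ = cong (λ j → ones s j ℓ) (sym (+-identityʳ i))
ones-+ s i (suc k) ℓ = begin
  bit (s i) + ones s (suc i) (k + ℓ)
    ≡⟨ cong (bit (s i) +_) (ones-+ s (suc i) k ℓ) ⟩
  bit (s i) + (ones s (suc i) k + ones s (suc i + k) ℓ)
    ≡⟨ sym (+-assoc (bit (s i)) _ _) ⟩
  bit (s i) + ones s (suc i) k + ones s (suc i + k) ℓ
    ≡⟨ cong (λ j → bit (s i) + ones s (suc i) k + ones s j ℓ) (sym (+-suc i k)) ⟩
  bit (s i) + ones s (suc i) k + ones s (i + suc k) ℓ ∎
  where open ≡-Reasoning

ones-snoc : ∀ s i ℓ → ones s i (suc ℓ) ≡ ones s i ℓ + bit (s (i + ℓ))
ones-snoc s i ℓ = begin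
  ones s i (suc ℓ)                        ≡⟨ cong (ones s i) (+-comm 1 ℓ) ⟩
  ones s i (ℓ + 1)                        ≡⟨ ones-+ s i ℓ 1 ⟩
  ones s i ℓ + (bit (s (i + ℓ)) + 0)      ≡⟨ cong (ones s i ℓ +_) (+-identityʳ _) ⟩
  ones s i ℓ + bit (s (i + ℓ))            ∎
  where open ≡-Reasoning

ones-cong : ∀ {s s′} i ℓ → (∀ j → i ≤ j → j < i + ℓ → s j ≡ s′ j) → ones s i ℓ ≡ ones s′ i ℓ
ones-cong i zero    eq = refl
ones-cong i (suc ℓ) eq = cong₂ _+_
  (cong bit (eq i ≤-refl (m<m+n i (s≤s z≤n))))
  (ones-cong (suc i) ℓ λ j i<j j<k → eq j (<⇒≤ i<j) (subst (j <_) (sym (+-suc i ℓ)) j<k))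

ones-shift : ∀ {s s′} n i ℓ → (∀ j → s (j + n) ≡ s′ j) → ones s (i + n) ℓ ≡ ones s′ i ℓ
ones-shift n i zero    eq = refl
ones-shift n i (suc ℓ) eq = cong₂ _+_ (cong bit (eq i)) (ones-shift n (suc i) ℓ eq)

_⊑_ : Seq → Seq → Set
s ⊑ s′ = ∀ i → s i ≡ true → s′ i ≡ true

bit-mono : ∀ b b′ → (b ≡ true → b′ ≡ true) → bit b ≤ bit b′
bit-mono false b′    h = z≤n
bit-mono true  true  h = ≤-refl
bit-mono true  false h with () ← h refl

ones-mono : ∀ {s s′} → s ⊑ s′ → ∀ i ℓ → ones s i ℓ ≤ ones s′ i ℓ
ones-mono h i zero    = z≤n
ones-mono h i (suc ℓ) = +-mono-≤ (bit-mono _ _ (h i)) (ones-mono h (suc i) ℓ)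

T⇒≡ : ∀ {b} → T b → b ≡ true
T⇒≡ {true} _ = refl

≡⇒T : ∀ {b} → b ≡ true → T b
≡⇒T refl = _

not-true : ∀ {b} → not b ≡ true → b ≡ false
not-true {false} _ = refl

not-⊑ : ∀ {s s′} → s ⊑ s′ → (not ∘ s′) ⊑ (not ∘ s)
not-⊑ {s} {s′} h i eq with s i in si
... | false = refl
... | true  with () ← trans (sym (h i si)) (not-true eq)

zeros-mono : ∀ {s s′} → s ⊑ s′ → ∀ i ℓ → zeros s′ i ℓ ≤ zeros s i ℓ
zeros-mono h = ones-mono (not-⊑ h)

zeros-cong : ∀ {s s′} i ℓ → (∀ j → i ≤ j → j < i + ℓ → s j ≡ s′ j) → zeros s i ℓ ≡ zeros s′ i ℓ
zeros-cong i ℓ eq = ones-cong i ℓ λ j p q → cong not (eq j p q)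

zeros-shift : ∀ {s s′} n i ℓ → (∀ j → s (j + n) ≡ s′ j) → zeros s (i + n) ℓ ≡ zeros s′ i ℓ
zeros-shift n i ℓ eq = ones-shift n i ℓ (cong not ∘ eq)

bit-not : ∀ b → bit b + bit (not b) ≡ 1
bit-not true  = refl
bit-not false = refl

ones+zeros : ∀ s i ℓ → ones s i ℓ + zeros s i ℓ ≡ ℓ
ones+zeros s i zero    = refl
ones+zeros s i (suc ℓ) = trans (regroup (bit (s i)) _ _ _)
  (cong₂ _+_ (bit-not (s i)) (ones+zeros s (suc i) ℓ))
  where
  regroup : ∀ a b c d → (a + b) + (c + d) ≡ (a + c) + (b + d)
  regroup = solve-∀

-- A ballot-type height that never needs a negative value: ones before t plus zeros from t on.
height : Seq → ℕ → ℕ → ℕ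
height s n t = ones s 0 t + zeros s t (n ∸ t)

height-step : ∀ s n t → t < n → height s n (suc t) + bit (not (s t)) ≡ height s n t + bit (s t)
height-step s n t t<n = begin
  ones s 0 (suc t) + Z + b̄            ≡⟨ cong (λ k → k + Z + b̄) (ones-snoc s 0 t) ⟩
  ones s 0 t + bit (s t) + Z + b̄      ≡⟨ regroup (ones s 0 t) (bit (s t)) Z b̄ ⟩
  ones s 0 t + (b̄ + Z) + bit (s t)    ≡⟨ cong (λ k → ones s 0 t + zeros s t k + bit (s t)) (sym (+-∸-assoc 1 t<n)) ⟩
  height s n t + bit (s t)            ∎
  where
  open ≡-Reasoning
  Z b̄ : ℕ
  Z = zeros s (suc t) (n ∸ suc t)
  b̄ = bit (not (s t))
  regroup : ∀ a b c d → a + b + c + d ≡ a + (d + c) + b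
  regroup = solve-∀

height-window : ∀ s n i ℓ → i + ℓ ≤ n →
  height s n (i + ℓ) + zeros s i ℓ ≡ height s n i + ones s i ℓ
height-window s n i zero    _ = cong (λ j → height s n j + 0) (+-identityʳ i)
height-window s n i (suc ℓ) le = begin
  height s n (i + suc ℓ) + zeros s i (suc ℓ)
    ≡⟨ cong₂ _+_ (cong (height s n) (+-suc i ℓ)) (ones-snoc (not ∘ s) i ℓ) ⟩
  height s n (suc (i + ℓ)) + (zeros s i ℓ + bit (not (s (i + ℓ))))
    ≡⟨ regroup (height s n (suc (i + ℓ))) _ _ ⟩
  height s n (suc (i + ℓ)) + bit (not (s (i + ℓ))) + zeros s i ℓ
    ≡⟨ cong (_+ zeros s i ℓ) (height-step s n (i + ℓ) i+ℓ<n) ⟩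
  height s n (i + ℓ) + bit (s (i + ℓ)) + zeros s i ℓ
    ≡⟨ regroup′ (height s n (i + ℓ)) _ _ ⟩
  height s n (i + ℓ) + zeros s i ℓ + bit (s (i + ℓ))
    ≡⟨ cong (_+ bit (s (i + ℓ))) (height-window s n i ℓ (<⇒≤ i+ℓ<n)) ⟩
  height s n i + ones s i ℓ + bit (s (i + ℓ))
    ≡⟨ +-assoc (height s n i) _ _ ⟩
  height s n i + (ones s i ℓ + bit (s (i + ℓ)))
    ≡⟨ cong (height s n i +_) (sym (ones-snoc s i ℓ)) ⟩
  height s n i + ones s i (suc ℓ) ∎
  where
  open ≡-Reasoning
  i+ℓ<n : i + ℓ < n
  i+ℓ<n = subst (_≤ n) (+-suc i ℓ) le
  regroup : ∀ a b c → a + (b + c) ≡ a + c + b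
  regroup = solve-∀
  regroup′ : ∀ a b c → a + b + c ≡ a + c + b
  regroup′ = solve-∀

height-up : ∀ s n t → t < n → s t ≡ true → height s n (suc t) ≡ suc (height s n t)
height-up s n t t<n eq with s t | height-step s n t t<n
height-up s n t t<n refl | true | st = trans (sym (+-identityʳ _)) (trans st (+-comm _ 1))

height-down : ∀ s n t → t < n → s t ≡ false → height s n t ≡ suc (height s n (suc t))
height-down s n t t<n eq with s t | height-step s n t t<n
height-down s n t t<n refl | false | st = trans (sym (+-identityʳ _)) (trans (sym st) (+-comm _ 1))

height-end : ∀ s n → height s n n ≡ ones s 0 n
height-end s n = trans (cong (λ k → ones s 0 n + zeros s n k) (n∸n≡0 n)) (+-identityʳ _)

height-rises : ∀ s n t → t < n → height s n (suc t) ≤ suc (height s n t)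
height-rises s n t t<n with s t in eq
... | true  = ≤-reflexive (height-up s n t t<n eq)
... | false = ≤-trans (n≤1+n _) (≤-trans (≤-reflexive (sym (height-down s n t t<n eq))) (n≤1+n _))

height-falls : ∀ s n t → t < n → height s n t ≤ suc (height s n (suc t))
height-falls s n t t<n with s t in eq
... | true  = ≤-trans (n≤1+n _) (≤-trans (≤-reflexive (sym (height-up s n t t<n eq))) (n≤1+n _))
... | false = ≤-reflexive (height-down s n t t<n eq)

-- Minima of tails and last passages.

low : (ℕ → ℕ) → ℕ → ℕ → ℕ
low g zero    t = g t
low g (suc ℓ) t = g t ⊓ low g ℓ (suc t)

low-≤ : ∀ g ℓ t j → t ≤ j → j ≤ t + ℓ → low g ℓ t ≤ g j
low-≤ g zero t j t≤j j≤t rewrite ≤-antisym t≤j (subst (j ≤_) (+-identityʳ t) j≤t) = ≤-refl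
low-≤ g (suc ℓ) t j t≤j j≤k with m≤n⇒m<n∨m≡n t≤j
... | inj₂ refl = m⊓n≤m _ _
... | inj₁ t<j  = ≤-trans (m⊓n≤n _ _) (low-≤ g ℓ (suc t) j t<j (subst (j ≤_) (+-suc t ℓ) j≤k))

low-attained : ∀ g ℓ t → ∃ λ j → t ≤ j × j ≤ t + ℓ × g j ≡ low g ℓ t
low-attained g zero    t = t , ≤-refl , m≤m+n t 0 , refl
low-attained g (suc ℓ) t with ≤-total (g t) (low g ℓ (suc t)) | low-attained g ℓ (suc t)
... | inj₁ le | _ = t , ≤-refl , m≤m+n t _ , sym (m≤n⇒m⊓n≡m le)
... | inj₂ ge | j , t<j , j≤k , eq =
  j , <⇒≤ t<j , subst (j ≤_) (sym (+-suc t ℓ)) j≤k , trans eq (sym (m≥n⇒m⊓n≡n ge))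

<-low : ∀ g ℓ t k → (∀ j → t ≤ j → j ≤ t + ℓ → k < g j) → k < low g ℓ t
<-low g ℓ t k h with low-attained g ℓ t
... | j , p , q , eq = subst (k <_) eq (h j p q)

-- From t on there is exactly one last passage for every height from the minimum of g on [t , n] up
-- to K, which determines the number of marked points from t on.
module LastPassages
  (g : ℕ → ℕ) (n K : ℕ) (u : Seq)
  (slow : ∀ t → t < n → g (suc t) ≤ suc (g t))
  (K≤end : K ≤ g n)
  (u-sound : ∀ t → t < n → u t ≡ true → (∀ j → t < j → j ≤ n → g t < g j) × g t < K)
  (u-complete : ∀ t → t < n → (∀ j → t < j → j ≤ n → g t < g j) → g t < K → u t ≡ true)
  where

  count-from : ∀ ℓ t → t + ℓ ≡ n → ones u t ℓ + (low g ℓ t ⊓ K) ≡ K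
  count-from zero    t refl = m≥n⇒m⊓n≡n (subst (λ j → K ≤ g j) (+-identityʳ t) K≤end)
  count-from (suc ℓ) t eq = go (u t) refl
    where
    open ≡-Reasoning
    M = low g ℓ (suc t)
    eq′ : suc t + ℓ ≡ n
    eq′ = trans (sym (+-suc t ℓ)) eq
    t<n : t < n
    t<n = subst (t <_) eq′ (m≤m+n (suc t) ℓ)
    IH : ones u (suc t) ℓ + (M ⊓ K) ≡ K
    IH = count-from ℓ (suc t) eq′
    M≤ : M ≤ suc (g t)
    M≤ = ≤-trans (low-≤ g ℓ (suc t) (suc t) ≤-refl (m≤m+n _ ℓ)) (slow t t<n)
    go : ∀ b → u t ≡ b → bit (u t) + ones u (suc t) ℓ + ((g t ⊓ M) ⊓ K) ≡ K
    go true ut with u-sound t t<n ut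
    ... | gt< , gt<K = begin
      bit (u t) + ones u (suc t) ℓ + ((g t ⊓ M) ⊓ K)
        ≡⟨ cong₂ (λ b k → bit b + ones u (suc t) ℓ + (k ⊓ K)) ut (m≤n⇒m⊓n≡m (<⇒≤ gt<M)) ⟩
      suc (ones u (suc t) ℓ) + (g t ⊓ K)
        ≡⟨ cong (suc (ones u (suc t) ℓ) +_) (m≤n⇒m⊓n≡m (<⇒≤ gt<K)) ⟩
      suc (ones u (suc t) ℓ + g t)
        ≡⟨ sym (+-suc _ (g t)) ⟩
      ones u (suc t) ℓ + suc (g t)
        ≡⟨ cong (ones u (suc t) ℓ +_) (sym (m≤n⇒m⊓n≡m gt<K)) ⟩
      ones u (suc t) ℓ + (suc (g t) ⊓ K)
        -- A last passage lies strictly below the rest, and heights rise by at most one, so the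
        -- later minimum is exactly one higher.
        ≡⟨ cong (λ k → ones u (suc t) ℓ + (k ⊓ K)) (sym (≤-antisym M≤ gt<M)) ⟩
      ones u (suc t) ℓ + (M ⊓ K)
        ≡⟨ IH ⟩
      K ∎
      where
      gt<M : g t < M
      gt<M = <-low g ℓ (suc t) (g t) λ j p q → gt< j p (subst (j ≤_) eq′ q)
    go false ut = begin
      bit (u t) + ones u (suc t) ℓ + ((g t ⊓ M) ⊓ K)
        ≡⟨ cong₂ (λ b k → bit b + ones u (suc t) ℓ + k) ut same ⟩
      ones u (suc t) ℓ + (M ⊓ K)
        ≡⟨ IH ⟩
      K ∎
      where
      -- An unmarked point is either no last passage or already at height `K` or more. In both cases
      -- the minimum truncated at `K` does not change.
      same : (g t ⊓ M) ⊓ K ≡ M ⊓ K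
      same with M ≤? g t | K ≤? g t
      ... | yes M≤gt | _ = cong (_⊓ K) (m≥n⇒m⊓n≡n M≤gt)
      ... | no M≰gt | yes K≤gt = begin
        (g t ⊓ M) ⊓ K  ≡⟨ cong (_⊓ K) (m≤n⇒m⊓n≡m (<⇒≤ (≰⇒> M≰gt))) ⟩
        g t ⊓ K        ≡⟨ m≥n⇒m⊓n≡n K≤gt ⟩
        K              ≡⟨ sym (m≥n⇒m⊓n≡n (≤-trans K≤gt (<⇒≤ (≰⇒> M≰gt)))) ⟩
        M ⊓ K          ∎
      ... | no M≰gt | no K≰gt with () ← trans (sym ut) (u-complete t t<n
              (λ j p q → <-≤-trans (≰⇒> M≰gt) (low-≤ g ℓ (suc t) j p (subst (j ≤_) (sym eq′) q)))
              (≰⇒> K≰gt))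

-- Free positions on the circle and their number.

-- The windows start after `i` and are too short to come round to it again. The condition is thus
-- independent of the entry at `i` and says that `i` is free as soon as that entry is a one.
Opn : Seq → ℕ → ℕ → Set
Opn s n i = ∀ {ℓ} → ℓ < n → zeros s (suc i) ℓ ≤ ones s (suc i) ℓ

opn? : ∀ s n → Decidable (Opn s n)
opn? s n i = allUpTo? (λ ℓ → zeros s (suc i) ℓ ≤? ones s (suc i) ℓ) n

Pos : Seq → ℕ → ℕ → Set
Pos s n i = ∀ ℓ → 0 < ℓ → ℓ ≤ n → zeros s i ℓ < ones s i ℓ

pos : ∀ {s n i} → s i ≡ true → Opn s n i → Pos s n i
pos {s} {n} {i} si op (suc ℓ) _ ℓ<n rewrite si = s≤s (op ℓ<n)

pos⇒one : ∀ {s n i} → 0 < n → Pos s n i → s i ≡ true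
pos⇒one {s} {n} {i} 0<n P with s i | P 1 (s≤s z≤n) 0<n
... | true | _ = refl

pos⇒opn : ∀ {s n i} → 0 < n → Pos s n i → Opn s n i
pos⇒opn {s} {n} {i} 0<n P {ℓ} ℓ<n with s i | pos⇒one {s} 0<n P | P (suc ℓ) (s≤s z≤n) ℓ<n
... | true | refl | s≤s le = le

opaque
  free : Seq → ℕ → Seq
  free s n i = s i ∧ ⌊ opn? s n i ⌋

  free⇒pos : ∀ {s n i} → free s n i ≡ true → Pos s n i
  free⇒pos {s} {n} {i} eq with s i in si | opn? s n i
  ... | true | yes op = pos {s} si op

  pos⇒free : ∀ {s n i} → 0 < n → Pos s n i → free s n i ≡ true
  pos⇒free {s} {n} {i} 0<n P with opn? s n i
  ... | yes _ rewrite pos⇒one {s} 0<n P = refl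
  ... | no ¬op = ⊥-elim (¬op (pos⇒opn {s} 0<n P))

  free⇒one : ∀ {s n i} → free s n i ≡ true → s i ≡ true
  free⇒one {s} {n} {i} eq with s i
  ... | true = refl

module Linear (s : Seq) (n : ℕ) (periodic : ∀ j → s (j + n) ≡ s j)
              (m : ℕ) (rise : height s n n ≡ height s n 0 + m) where

  g : ℕ → ℕ
  g = height s n

  -- Freeness in terms of heights on a single period. The second clause is the first one continued
  -- into the next period, where every height is larger by `m`.
  Ahead : ℕ → Set
  Ahead i = (∀ t → i < t → t ≤ n → g i < g t) × (∀ t → t ≤ n → g i < g t + m)

  private
    lt₁ : ∀ {a b z o} → a + z ≡ b + o → b < a → z < o
    lt₁ {a} {b} {z} {o} eq b<a = +-cancelˡ-< a _ _ (begin-strict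
      a + z ≡⟨ eq ⟩
      b + o <⟨ +-monoˡ-< o b<a ⟩
      a + o ∎)
      where open ≤-Reasoning

    le₁ : ∀ {a b z o} → a + z ≡ b + o → b ≤ a → z ≤ o
    le₁ {a} {b} {z} {o} eq b≤a = +-cancelˡ-≤ a _ _ (begin
      a + z ≡⟨ eq ⟩
      b + o ≤⟨ +-monoˡ-≤ o b≤a ⟩
      a + o ∎)
      where open ≤-Reasoning

    tl₁ : ∀ {a b z o} → a + z ≡ b + o → z < o → b < a
    tl₁ {a} {b} {z} {o} eq z<o = +-cancelʳ-< o _ _ (begin-strict
      b + o ≡⟨ sym eq ⟩
      a + z <⟨ +-monoʳ-< a z<o ⟩
      a + o ∎)
      where open ≤-Reasoning

    -- By periodicity a window that wraps around is one from i to n followed by one from 0 to t.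
    wrap : ∀ i t → i ≤ n → t ≤ n →
      (g t + m) + zeros s i ((n ∸ i) + t) ≡ g i + ones s i ((n ∸ i) + t)
    wrap i t i≤n t≤n = +-cancelˡ-≡ (g 0) _ _ (begin
      g 0 + ((g t + m) + zeros s i ((n ∸ i) + t))
        ≡⟨ cong (λ z → g 0 + ((g t + m) + z)) (split (not ∘ s) (cong not ∘ periodic)) ⟩
      g 0 + ((g t + m) + (zeros s i (n ∸ i) + zeros s 0 t))
        ≡⟨ rg₁ (g 0) (g t) m _ _ ⟩
      ((g 0 + m) + zeros s i (n ∸ i)) + (g t + zeros s 0 t)
        ≡⟨ cong (λ k → (k + zeros s i (n ∸ i)) + (g t + zeros s 0 t)) (sym rise) ⟩
      (g n + zeros s i (n ∸ i)) + (g t + zeros s 0 t)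
        ≡⟨ cong₂ _+_ w₁ (height-window s n 0 t t≤n) ⟩
      (g i + ones s i (n ∸ i)) + (g 0 + ones s 0 t)
        ≡⟨ rg₂ (g i) _ (g 0) _ ⟩
      g 0 + (g i + (ones s i (n ∸ i) + ones s 0 t))
        ≡⟨ cong (λ z → g 0 + (g i + z)) (sym (split s periodic)) ⟩
      g 0 + (g i + ones s i ((n ∸ i) + t)) ∎)
      where
      open ≡-Reasoning
      split : ∀ (r : Seq) → (∀ j → r (j + n) ≡ r j) →
        ones r i ((n ∸ i) + t) ≡ ones r i (n ∸ i) + ones r 0 t
      split r per = trans (ones-+ r i (n ∸ i) t)
        (cong (ones r i (n ∸ i) +_) (trans (cong (λ j → ones r j t) (m+[n∸m]≡n i≤n)) (ones-shift n 0 t per)))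
      w₁ : g n + zeros s i (n ∸ i) ≡ g i + ones s i (n ∸ i)
      w₁ = subst (λ j → g j + zeros s i (n ∸ i) ≡ g i + ones s i (n ∸ i)) (m+[n∸m]≡n i≤n)
        (height-window s n i (n ∸ i) (≤-reflexive (m+[n∸m]≡n i≤n)))
      rg₁ : ∀ a b c d e → a + ((b + c) + (d + e)) ≡ ((a + c) + d) + (b + e)
      rg₁ = solve-∀
      rg₂ : ∀ a b c d → (a + b) + (c + d) ≡ c + (a + (b + d))
      rg₂ = solve-∀

  ahead⇒pos : ∀ {i} → i < n → Ahead i → Pos s n i
  ahead⇒pos {i} i<n (p , q) ℓ 0<ℓ ℓ≤n with i + ℓ ≤? n
  ... | yes le = lt₁ (height-window s n i ℓ le) (p (i + ℓ) (m<m+n i 0<ℓ) le)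
  ... | no nle = subst (λ k → zeros s i k < ones s i k) (m+[n∸m]≡n n∸i≤ℓ)
          (lt₁ (wrap i t (<⇒≤ i<n) t≤n) (q t t≤n))
    where
    n∸i≤ℓ : n ∸ i ≤ ℓ
    n∸i≤ℓ = m≤n+o⇒m∸n≤o n i (<⇒≤ (≰⇒> nle))
    t = ℓ ∸ (n ∸ i)
    t≤n : t ≤ n
    t≤n = ≤-trans (m∸n≤m ℓ (n ∸ i)) ℓ≤n

  pos⇒ahead : ∀ {i} → i < n → Pos s n i → Ahead i
  pos⇒ahead {i} i<n P = after , around
    where
    after : ∀ t → i < t → t ≤ n → g i < g t
    after t i<t t≤n with m≤n⇒∃[o]m+o≡n (<⇒≤ i<t)
    ... | ℓ , refl = tl₁ (height-window s n i ℓ t≤n)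
      (P ℓ (+-cancelˡ-< i 0 ℓ (subst (_< i + ℓ) (sym (+-identityʳ i)) i<t)) (≤-trans (m≤n+m ℓ i) t≤n))
    around : ∀ t → t ≤ n → g i < g t + m
    around t t≤n with i <? t
    -- Here the wrapped window would be longer than a period, so `Pos` says nothing about it; the
    -- bound without wrapping is used instead.
    ... | yes i<t = <-≤-trans (after t i<t t≤n) (m≤m+n _ m)
    ... | no i≮t = tl₁ (wrap i t (<⇒≤ i<n) t≤n)
          (P _ (<-≤-trans (m<n⇒0<n∸m i<n) (m≤m+n _ t))
            (≤-trans (+-monoʳ-≤ (n ∸ i) (≮⇒≥ i≮t)) (≤-reflexive (m∸n+n≡m (<⇒≤ i<n)))))

  μ : ℕ
  μ = low g n 0

  u : Seq
  u = free s n

  μ≤g : ∀ t → t ≤ n → μ ≤ g t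
  μ≤g t t≤n = low-≤ g n 0 t z≤n t≤n

  -- At a point where `μ` is attained, the wrapped clause of `Ahead` becomes the bound
  -- `g t < μ + m`. As `μ` is the minimum, this bound gives the whole clause back in `u-complete`.
  -- Free points are therefore the last passages that `LastPassages` counts for `K = μ + m`.
  u-sound : ∀ t → t < n → u t ≡ true → (∀ j → t < j → j ≤ n → g t < g j) × g t < μ + m
  u-sound t t<n ut with pos⇒ahead t<n (free⇒pos {s} ut) | low-attained g n 0
  ... | p , q | j , _ , j≤n , eq = p , subst (λ k → g t < k + m) eq (q j j≤n)

  u-complete : ∀ t → t < n → (∀ j → t < j → j ≤ n → g t < g j) → g t < μ + m → u t ≡ true
  u-complete t t<n p gt< = pos⇒free {s} (≤-<-trans z≤n t<n)
    (ahead⇒pos t<n (p , λ j j≤n → <-≤-trans gt< (+-monoˡ-≤ m (μ≤g j j≤n))))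

  open LastPassages g n (μ + m) u (height-rises s n)
    (≤-trans (+-monoˡ-≤ m (μ≤g 0 z≤n)) (≤-reflexive (sym rise))) u-sound u-complete

  -- The minimum over the period is `μ`, so the last passages below `μ + m` occupy the heights from
  -- `μ` to `μ + m - 1`, one each.
  count-u : ones u 0 n ≡ m
  count-u = +-cancelʳ-≡ μ _ _ (begin
    ones u 0 n + μ               ≡⟨ cong (ones u 0 n +_) (sym (m≤n⇒m⊓n≡m (m≤m+n μ m))) ⟩
    ones u 0 n + (μ ⊓ (μ + m))   ≡⟨ count-from n 0 refl ⟩
    μ + m                        ≡⟨ +-comm μ m ⟩
    m + μ                        ∎)
    where open ≡-Reasoning

  -- The total minus `count-from` at `t`: the free points still to come fill the heights from the
  -- minimum of the tail up to `μ + m`, and the earlier ones fill the heights below.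
  count-u-before : ∀ t → t ≤ n → ones u 0 t + μ ≡ low g (n ∸ t) t ⊓ (μ + m)
  count-u-before t t≤n = +-cancelˡ-≡ (ones u t (n ∸ t)) _ _ (begin
    ones u t (n ∸ t) + (ones u 0 t + μ)  ≡⟨ rg (ones u t (n ∸ t)) (ones u 0 t) μ ⟩
    (ones u 0 t + ones u t (n ∸ t)) + μ  ≡⟨ cong (_+ μ) (sym (ones-+ u 0 t (n ∸ t))) ⟩
    ones u 0 (t + (n ∸ t)) + μ           ≡⟨ cong (λ k → ones u 0 k + μ) (m+[n∸m]≡n t≤n) ⟩
    ones u 0 n + μ                       ≡⟨ cong (_+ μ) count-u ⟩
    m + μ                                ≡⟨ +-comm m μ ⟩
    μ + m                                ≡⟨ sym (count-from (n ∸ t) t (m+[n∸m]≡n t≤n)) ⟩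
    ones u t (n ∸ t) + (low g (n ∸ t) t ⊓ (μ + m)) ∎)
    where
    open ≡-Reasoning
    rg : ∀ a b c → a + (b + c) ≡ (b + a) + c
    rg = solve-∀

  count-u-≤ : ∀ t → t ≤ n → ones u 0 t + μ ≤ g t
  count-u-≤ t t≤n = ≤-trans (≤-reflexive (count-u-before t t≤n))
    (≤-trans (m⊓n≤m _ _) (low-≤ g (n ∸ t) t t ≤-refl (m≤m+n t _)))

  -- A last passage is the minimum of its own tail, and a free one lies below `μ + m`, so both
  -- minima in `count-u-before` reduce to `g t`.
  count-u-at : ∀ t → t < n → u t ≡ true → ones u 0 t + μ ≡ g t
  count-u-at t t<n ut with u-sound t t<n ut | low-attained g (n ∸ t) t
  ... | p , gt<K | j , t≤j , j≤k , eq = trans (count-u-before t (<⇒≤ t<n))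
    (trans (cong (_⊓ (μ + m)) low≡) (m≤n⇒m⊓n≡m (<⇒≤ gt<K)))
    where
    low≡ : low g (n ∸ t) t ≡ g t
    low≡ with m≤n⇒m<n∨m≡n t≤j
    ... | inj₂ refl = sym eq
    ... | inj₁ t<j = ⊥-elim (<-irrefl refl (<-≤-trans (p j t<j (subst (j ≤_) (m+[n∸m]≡n (<⇒≤ t<n)) j≤k))
      (≤-trans (≤-reflexive eq) (low-≤ g (n ∸ t) t t ≤-refl (m≤m+n t _)))))

  window-≥ : ∀ j → j ≤ n → (∀ t → t ≤ n → g j ≤ g t) → ∀ {ℓ} → ℓ ≤ n → zeros s j ℓ ≤ ones s j ℓ
  window-≥ j j≤n least {ℓ} ℓ≤n with j + ℓ ≤? n
  ... | yes le = le₁ (height-window s n j ℓ le) (least (j + ℓ) le)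
  ... | no nle = subst (λ k → zeros s j k ≤ ones s j k) (m+[n∸m]≡n n∸j≤ℓ)
          (le₁ (wrap j t j≤n t≤n) (≤-trans (least t t≤n) (m≤m+n _ m)))
    where
    n∸j≤ℓ : n ∸ j ≤ ℓ
    n∸j≤ℓ = m≤n+o⇒m∸n≤o n j (<⇒≤ (≰⇒> nle))
    t = ℓ ∸ (n ∸ j)
    t≤n : t ≤ n
    t≤n = ≤-trans (m∸n≤m ℓ (n ∸ j)) ℓ≤n

  -- The index just before a point of minimum height works: its windows start at the minimum, from
  -- where no height is lower, and wrapping round only adds `m`.
  opn-exists : 0 < n → ∃ λ i → i < n × Opn s n i
  opn-exists 0<n with low-attained g n 0
  ... | suc j , _ , j<n , eq = j , j<n , λ {ℓ} ℓ<n →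
        window-≥ (suc j) j<n (λ t t≤n → ≤-trans (≤-reflexive eq) (μ≤g t t≤n)) (<⇒≤ ℓ<n)
  -- The minimum is at 0, whose cyclic predecessor is `n ∸ 1`; the windows then start at `n` and are
  -- shifted back by one period.
  ... | zero  , _ , _   , eq = n ∸ 1 , ∸-monoʳ-< (s≤s z≤n) 0<n , λ {ℓ} ℓ<n →
        subst (λ j → zeros s j ℓ ≤ ones s j ℓ) (sym (m+[n∸m]≡n 0<n))
          (subst₂ _≤_ (sym (zeros-shift n 0 ℓ periodic)) (sym (ones-shift n 0 ℓ periodic))
            (window-≥ 0 z≤n (λ t t≤n → ≤-trans (≤-reflexive eq) (μ≤g t t≤n)) (<⇒≤ ℓ<n)))

-- Subsets as periodic sequences.

per : ∀ {n} → Subset n → Seq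
per {zero}  x i = false
per {suc n} x i = lookup x (i mod suc n)

toℕ-mod : ∀ i n .{{_ : NonZero n}} → toℕ (i mod n) ≡ i % n
toℕ-mod i n = toℕ-fromℕ< (m%n<n i n)

per-toℕ : ∀ {n} (x : Subset n) i → per x (toℕ i) ≡ lookup x i
per-toℕ {suc n} x i = cong (lookup x) (toℕ-injective
  (trans (toℕ-mod (toℕ i) (suc n)) (m<n⇒m%n≡m (toℕ<n i))))

per-< : ∀ {n} (x : Subset n) {t} (t<n : t < n) → per x t ≡ lookup x (fromℕ< t<n)
per-< x t<n = trans (cong (per x) (sym (toℕ-fromℕ< t<n))) (per-toℕ x (fromℕ< t<n))

per-periodic : ∀ {n} (x : Subset n) j → per x (j + n) ≡ per x j
per-periodic {zero}  x j = refl
per-periodic {suc n} x j = cong (lookup x) (toℕ-injective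
  (trans (toℕ-mod (j + suc n) (suc n))
    (trans ([m+n]%n≡m%n j (suc n)) (sym (toℕ-mod j (suc n))))))

∣∣-ones-from : ∀ {n} (x : Subset n) (s : Seq) k → (∀ i → s (k + toℕ i) ≡ lookup x i) → ∣ x ∣ ≡ ones s k n
∣∣-ones-from []      s k h = refl
∣∣-ones-from (b ∷ x) s k h
  rewrite trans (sym (cong s (+-identityʳ k))) (h zero)
  with b | ∣∣-ones-from x s (suc k) (λ i → trans (cong s (sym (+-suc k (toℕ i)))) (h (suc i)))
... | true  | eq = cong suc eq
... | false | eq = eq

∣∣-ones : ∀ {n} (x : Subset n) → ∣ x ∣ ≡ ones (per x) 0 n
∣∣-ones x = ∣∣-ones-from x (per x) 0 (per-toℕ x)

-- The signature expressed by heights.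

module Signature {n} (x : Subset n) where

  s : Seq
  s = per x

  g : ℕ → ℕ
  g = height s n

  sign : Bool → ℤ
  sign b = if b then ℤ.+ 1 else -[1+ 0 ]

  within : ℕ → ℕ → Fin n → Bool
  within i j k = ⌊ i ≤? toℕ k ⌋ ∧ ⌊ toℕ k ≤? j ⌋

  total : ℕ → ℕ → List (Fin n) → ℤ
  total i j ks = L.foldr ℤ._+_ (ℤ.+ 0) (L.map (λ k → sign (lookup x k)) (filterᵇ (within i j) ks))

  total-skip : ∀ i j k ks → ¬ (i ≤ toℕ k × toℕ k ≤ j) → total i j (k L.∷ ks) ≡ total i j ks
  total-skip i j k ks out with i ≤? toℕ k | toℕ k ≤? j
  ... | yes p | yes q = ⊥-elim (out (p , q))
  ... | yes _ | no _  = refl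
  ... | no _  | _     = refl

  total-take : ∀ i j k ks → i ≤ toℕ k → toℕ k ≤ j →
    total i j (k L.∷ ks) ≡ sign (lookup x k) ℤ.+ total i j ks
  total-take i j k ks p q with i ≤? toℕ k | toℕ k ≤? j
  ... | yes _ | yes _ = refl
  ... | yes _ | no ¬q = ⊥-elim (¬q q)
  ... | no ¬p | _     = ⊥-elim (¬p p)

  module _ {i j : ℕ} where

    head-pos : ∀ {k b} {h : Fin (suc k) → Fin n} → (∀ r → toℕ (h r) ≡ b + toℕ r) → toℕ (h zero) ≡ b
    head-pos {b = b} pos = trans (pos zero) (+-identityʳ b)

    tail-pos : ∀ {k b} {h : Fin (suc k) → Fin n} → (∀ r → toℕ (h r) ≡ b + toℕ r) →
      ∀ r → toℕ (h (suc r)) ≡ suc b + toℕ r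
    tail-pos {b = b} pos r = trans (pos (suc r)) (+-suc b (toℕ r))

    -- The sum in `c` runs over `allFin n`; the induction needs any list `h` of consecutive indices
    -- from `b` on. Indices before `i` are skipped in `total-from`, those of the window are added in
    -- `total-window`, and the rest falls under this case.
    total-past : ∀ k b (h : Fin k → Fin n) → (∀ r → toℕ (h r) ≡ b + toℕ r) → j < b →
      total i j (L.tabulate h) ≡ ℤ.+ 0
    total-past zero    b h pos j<b = refl
    total-past (suc k) b h pos j<b = trans
      (total-skip i j (h zero) _ λ (_ , q) → <-irrefl refl (<-≤-trans j<b (subst (_≤ j) (head-pos pos) q)))
      (total-past k (suc b) (h ∘ suc) (tail-pos pos) (m≤n⇒m≤1+n j<b))

    sign-⊖ : ∀ b o z → sign b ℤ.+ (o ⊖ z) ≡ (bit b + o) ⊖ (bit (not b) + z)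
    sign-⊖ true  o z = ℤ.distribʳ-⊖-+-pos 1 o z
    sign-⊖ false o z = ℤ.distribʳ-⊖-+-neg 0 o z

    total-window : ∀ ℓ k b (h : Fin k → Fin n) → (∀ r → toℕ (h r) ≡ b + toℕ r) → i ≤ b → suc j ≡ b + ℓ → ℓ ≤ k →
      total i j (L.tabulate h) ≡ ones s b ℓ ⊖ zeros s b ℓ
    total-window zero    k b h pos i≤b eq ℓ≤k = total-past k b h pos (≤-reflexive (trans eq (+-identityʳ b)))
    total-window (suc ℓ) (suc k) b h pos i≤b eq (s≤s ℓ≤k) = begin
      total i j (L.tabulate h)
        ≡⟨ total-take i j (h zero) _ (subst (i ≤_) (sym (head-pos pos)) i≤b)
            (subst (_≤ j) (sym (head-pos pos)) (subst (b ≤_) (sym (suc-injective (trans eq (+-suc b ℓ)))) (m≤m+n b ℓ))) ⟩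
      sign (lookup x (h zero)) ℤ.+ total i j (L.tabulate (h ∘ suc))
        ≡⟨ cong₂ ℤ._+_ (cong sign (trans (sym (per-toℕ x (h zero))) (cong s (head-pos pos))))
            (total-window ℓ k (suc b) (h ∘ suc) (tail-pos pos) (m≤n⇒m≤1+n i≤b) (trans eq (+-suc b ℓ)) ℓ≤k) ⟩
      sign (s b) ℤ.+ (ones s (suc b) ℓ ⊖ zeros s (suc b) ℓ)
        ≡⟨ sign-⊖ (s b) _ _ ⟩
      ones s b (suc ℓ) ⊖ zeros s b (suc ℓ) ∎
      where open ≡-Reasoning

    total-from : ∀ d ℓ k b (h : Fin k → Fin n) → (∀ r → toℕ (h r) ≡ b + toℕ r) →
      i ≡ b + d → suc j ≡ i + ℓ → d + ℓ ≤ k →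
      total i j (L.tabulate h) ≡ ones s i ℓ ⊖ zeros s i ℓ
    total-from zero ℓ k b h pos refl eq le =
      trans (total-window ℓ k b h pos (≤-reflexive (+-identityʳ b))
              (trans eq (cong (_+ ℓ) (+-identityʳ b))) le)
        (cong (λ q → ones s q ℓ ⊖ zeros s q ℓ) (sym (+-identityʳ b)))
    total-from (suc d) ℓ (suc k) b h pos eqi eq (s≤s le) = trans
      (total-skip i j (h zero) _ λ (p , _) → <-irrefl refl
        (<-≤-trans (m<m+n b (s≤s z≤n)) (subst₂ _≤_ eqi (head-pos pos) p)))
      (total-from d ℓ k (suc b) (h ∘ suc) (tail-pos pos) (trans eqi (+-suc b d)) eq le)

  c-window : ∀ i j ℓ → suc (toℕ j) ≡ toℕ i + ℓ → c x i j ≡ ones s (toℕ i) ℓ ⊖ zeros s (toℕ i) ℓ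
  c-window i j ℓ eq = total-from (toℕ i) ℓ n 0 (λ k → k) (λ _ → refl) refl eq (subst (_≤ n) eq (toℕ<n j))

  c≡0⇒ : ∀ i j → toℕ i < toℕ j → c x i j ≡ ℤ.+ 0 → g (suc (toℕ j)) ≡ g (toℕ i)
  c≡0⇒ i j i<j c0 with m≤n⇒∃[o]m+o≡n (m≤n⇒m≤1+n (<⇒≤ i<j))
  ... | ℓ , eq = +-cancelʳ-≡ (ones s (toℕ i) ℓ) _ _ (begin
    g (suc (toℕ j)) + ones s (toℕ i) ℓ   ≡⟨ cong₂ (λ q o → g q + o) (sym eq) o≡z ⟩
    g (toℕ i + ℓ) + zeros s (toℕ i) ℓ    ≡⟨ height-window s n (toℕ i) ℓ (subst (_≤ n) (sym eq) (toℕ<n j)) ⟩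
    g (toℕ i) + ones s (toℕ i) ℓ         ∎)
    where
    open ≡-Reasoning
    o≡z : ones s (toℕ i) ℓ ≡ zeros s (toℕ i) ℓ
    o≡z = ℤ.+-injective (ℤ.i-j≡0⇒i≡j _ _ (trans (ℤ.m-n≡m⊖n _ (zeros s (toℕ i) ℓ)) (trans (sym (c-window i j ℓ (sym eq))) c0)))

  ⇒c≡0 : ∀ i j → toℕ i < toℕ j → g (suc (toℕ j)) ≡ g (toℕ i) → c x i j ≡ ℤ.+ 0
  ⇒c≡0 i j i<j gg with m≤n⇒∃[o]m+o≡n (m≤n⇒m≤1+n (<⇒≤ i<j))
  ... | ℓ , eq = trans (c-window i j ℓ (sym eq))
      (trans (cong (ones s (toℕ i) ℓ ⊖_) z≡o) (ℤ.n⊖n≡0 (ones s (toℕ i) ℓ)))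
    where
    z≡o : zeros s (toℕ i) ℓ ≡ ones s (toℕ i) ℓ
    z≡o = +-cancelˡ-≡ (g (toℕ i)) _ _ (trans
      (cong (_+ zeros s (toℕ i) ℓ) (trans (sym gg) (cong g (sym eq))))
      (height-window s n (toℕ i) ℓ (subst (_≤ n) (sym eq) (toℕ<n j))))

  up : ∀ {i} → lookup x i ≡ true → g (suc (toℕ i)) ≡ suc (g (toℕ i))
  up {i} xi = height-up s n (toℕ i) (toℕ<n i) (trans (per-toℕ x i) xi)

  down : ∀ {i} → lookup x i ≡ false → g (toℕ i) ≡ suc (g (suc (toℕ i)))
  down {i} xi = height-down s n (toℕ i) (toℕ<n i) (trans (per-toℕ x i) xi)

  -- Discrete intermediate value theorem: a step lowers the height by at most one, so no value in
  -- between is jumped over.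
  crossing-down : ∀ ℓ t v → t + ℓ ≤ n → v ≤ g t → g (t + ℓ) ≤ v → ∃ λ j → t ≤ j × j ≤ t + ℓ × g j ≡ v
  crossing-down zero t v le v≤ ≤v rewrite +-identityʳ t = t , ≤-refl , ≤-refl , ≤-antisym ≤v v≤
  crossing-down (suc ℓ) t v le v≤ ≤v with m≤n⇒m<n∨m≡n v≤
  ... | inj₂ v≡ = t , ≤-refl , m≤m+n t _ , sym v≡
  ... | inj₁ v< rewrite +-suc t ℓ
    with crossing-down ℓ (suc t) v le (≤-pred (≤-trans v< (height-falls s n t (≤-trans (s≤s (m≤m+n t ℓ)) le)))) ≤v
  ... | j , p , q , eq = j , <⇒≤ p , q , eq

  crossing-up : ∀ ℓ t v → t + ℓ ≤ n → g t ≤ v → v ≤ g (t + ℓ) → ∃ λ j → t ≤ j × j ≤ t + ℓ × g j ≡ v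
  crossing-up zero t v le ≤v v≤ rewrite +-identityʳ t = t , ≤-refl , ≤-refl , ≤-antisym ≤v v≤
  crossing-up (suc ℓ) t v le ≤v v≤ with m≤n⇒m<n∨m≡n ≤v
  ... | inj₂ v≡ = t , ≤-refl , m≤m+n t _ , v≡
  ... | inj₁ <v rewrite +-suc t ℓ
    with crossing-up ℓ (suc t) v le (≤-trans (height-rises s n t (≤-trans (s≤s (m≤m+n t ℓ)) le)) <v) v≤
  ... | j , p , q , eq = j , <⇒≤ p , q , eq

  any-true : ∀ (P : Fin n → Bool) j → P j ≡ true → any P (allFin n) ≡ true
  any-true P j Pj = T⇒≡ (any⁺ P (lose (∈-allFin j) (≡⇒T Pj)))

  any-false : ∀ (P : Fin n → Bool) → (∀ j → P j ≡ true → ⊥) → any P (allFin n) ≡ false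
  any-false P h with any P (allFin n) in eq
  ... | false = refl
  ... | true  with satisfied (any⁻ P (allFin n) (subst T (sym eq) _))
  ... | j , Pj = ⊥-elim (h j (T⇒≡ Pj))

  both : ∀ {P Q : Set} (P? : Dec P) (Q? : Dec Q) → P → Q → ⌊ P? ⌋ ∧ ⌊ Q? ⌋ ≡ true
  both (yes _) (yes _) p q = refl
  both (no ¬p) _       p q = ⊥-elim (¬p p)
  both (yes _) (no ¬q) p q = ⊥-elim (¬q q)

  unboth : ∀ {P Q : Set} (P? : Dec P) (Q? : Dec Q) → ⌊ P? ⌋ ∧ ⌊ Q? ⌋ ≡ true → P × Q
  unboth (yes p) (yes q) _ = p , q

  -- `sgAt` asks for a window of balance 0, that is, for an equality of heights. At a one the
  -- inequality is equivalent, because the height first rises by one and has to come back through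
  -- its old value; and unlike the equality it can be followed when elements are removed. `Opened`
  -- is the mirror image for zeros.
  Closed : Fin n → Set
  Closed i = ∃ λ t → t < suc n × (toℕ i < t × g t ≤ g (toℕ i))

  Opened : Fin n → Set
  Opened i = ∃ λ t → t < suc (toℕ i) × g t ≤ g (suc (toℕ i))

  closed? : ∀ i → Dec (Closed i)
  closed? i = anyUpTo? (λ t → (toℕ i <? t) ×-dec (g t ≤? g (toℕ i))) (suc n)

  opened? : ∀ i → Dec (Opened i)
  opened? i = anyUpTo? (λ t → g t ≤? g (suc (toℕ i))) (suc (toℕ i))

  ¬closed : ∀ {i} → ¬ Closed i → ∀ t → toℕ i < t → t ≤ n → g (toℕ i) < g t
  ¬closed ¬c t i<t t≤n = ≰⇒> λ le → ¬c (t , s≤s t≤n , i<t , le)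

  ¬opened : ∀ {i} → ¬ Opened i → ∀ t → t ≤ toℕ i → g (suc (toℕ i)) < g t
  ¬opened ¬o t t≤i = ≰⇒> λ le → ¬o (t , s≤s t≤i , le)

  sgAt-true : ∀ {i} → lookup x i ≡ true → sgAt x i ≡
    (if any (λ k → ⌊ toℕ i <? toℕ k ⌋ ∧ ⌊ c x i k ℤ.≟ ℤ.+ 0 ⌋) (allFin n) then s1 else s*)
  sgAt-true {i} xi with lookup x i
  sgAt-true {i} refl | true = refl

  sgAt-false : ∀ {i} → lookup x i ≡ false → sgAt x i ≡
    (if any (λ k → ⌊ toℕ k <? toℕ i ⌋ ∧ ⌊ c x k i ℤ.≟ ℤ.+ 0 ⌋) (allFin n) then s0 else s*)
  sgAt-false {i} xi with lookup x i
  sgAt-false {i} refl | false = refl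

  sg-closed : ∀ {i} → lookup x i ≡ true → Closed i → sgAt x i ≡ s1
  sg-closed {i} xi (t , s≤s t≤n , i<t , gt≤) with up {i} xi | m≤n⇒∃[o]m+o≡n i<t
  ... | gi | ℓ , refl with crossing-down ℓ (suc (toℕ i)) (g (toℕ i)) t≤n (≤-trans (n≤1+n _) (≤-reflexive (sym gi))) gt≤
  -- The window ends at `j`, one before the crossing point. It has at least two elements, since the
  -- height at `suc i` is still one too high.
  ... | suc j , s≤s i≤j , j≤ , eq =
    trans (sgAt-true xi) (cong (λ b → if b then s1 else s*) (any-true (λ k → ⌊ toℕ i <? toℕ k ⌋ ∧ ⌊ c x i k ℤ.≟ ℤ.+ 0 ⌋) k Pk))
    where
    j<n : j < n
    j<n = ≤-trans j≤ t≤n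
    k : Fin n
    k = fromℕ< j<n
    i≢j : toℕ i ≢ j
    i≢j i≡j = 1+n≢n (trans (sym gi) (trans (cong (g ∘ suc) i≡j) eq))
    i<k : toℕ i < toℕ k
    i<k = subst (toℕ i <_) (sym (toℕ-fromℕ< j<n)) (≤∧≢⇒< i≤j i≢j)
    Pk : ⌊ toℕ i <? toℕ k ⌋ ∧ ⌊ c x i k ℤ.≟ ℤ.+ 0 ⌋ ≡ true
    Pk = both (toℕ i <? toℕ k) (c x i k ℤ.≟ ℤ.+ 0) i<k
      (⇒c≡0 i k i<k (trans (cong (g ∘ suc) (toℕ-fromℕ< j<n)) eq))

  sg-¬closed : ∀ {i} → lookup x i ≡ true → ¬ Closed i → sgAt x i ≡ s*
  sg-¬closed {i} xi ¬c =
    trans (sgAt-true xi) (cong (λ b → if b then s1 else s*) (any-false (λ k → ⌊ toℕ i <? toℕ k ⌋ ∧ ⌊ c x i k ℤ.≟ ℤ.+ 0 ⌋) no-k))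
    where
    no-k : ∀ k → ⌊ toℕ i <? toℕ k ⌋ ∧ ⌊ c x i k ℤ.≟ ℤ.+ 0 ⌋ ≡ true → ⊥
    no-k k Pk with unboth (toℕ i <? toℕ k) (c x i k ℤ.≟ ℤ.+ 0) Pk
    ... | i<k , c0 = ¬c (suc (toℕ k) , s≤s (toℕ<n k) , m≤n⇒m≤1+n i<k , ≤-reflexive (c≡0⇒ i k i<k c0))

  sg-opened : ∀ {i} → lookup x i ≡ false → Opened i → sgAt x i ≡ s0
  sg-opened {i} xi (t , s≤s t≤i , gt≤) with down {i} xi | m≤n⇒∃[o]m+o≡n t≤i
  ... | gi | ℓ , i≡ with crossing-up ℓ t (g (suc (toℕ i))) (≤-trans (≤-reflexive i≡) (<⇒≤ (toℕ<n i))) gt≤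
                     (≤-trans (n≤1+n _) (≤-reflexive (trans (sym gi) (cong g (sym i≡)))))
  ... | j , t≤j , j≤ , eq =
    trans (sgAt-false xi) (cong (λ b → if b then s0 else s*) (any-true (λ k → ⌊ toℕ k <? toℕ i ⌋ ∧ ⌊ c x k i ℤ.≟ ℤ.+ 0 ⌋) k Pk))
    where
    i≢j : j ≢ toℕ i
    i≢j j≡i = 1+n≢n (trans (sym gi) (trans (cong g (sym j≡i)) eq))
    j<i : j < toℕ i
    j<i = ≤∧≢⇒< (subst (j ≤_) i≡ j≤) i≢j
    j<n : j < n
    j<n = <-trans j<i (toℕ<n i)
    k : Fin n
    k = fromℕ< j<n
    k<i : toℕ k < toℕ i
    k<i = subst (_< toℕ i) (sym (toℕ-fromℕ< j<n)) j<i
    Pk : ⌊ toℕ k <? toℕ i ⌋ ∧ ⌊ c x k i ℤ.≟ ℤ.+ 0 ⌋ ≡ true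
    Pk = both (toℕ k <? toℕ i) (c x k i ℤ.≟ ℤ.+ 0) k<i
      (⇒c≡0 k i k<i (trans (sym eq) (cong g (sym (toℕ-fromℕ< j<n)))))

  sg-¬opened : ∀ {i} → lookup x i ≡ false → ¬ Opened i → sgAt x i ≡ s*
  sg-¬opened {i} xi ¬o =
    trans (sgAt-false xi) (cong (λ b → if b then s0 else s*) (any-false (λ k → ⌊ toℕ k <? toℕ i ⌋ ∧ ⌊ c x k i ℤ.≟ ℤ.+ 0 ⌋) no-k))
    where
    no-k : ∀ k → ⌊ toℕ k <? toℕ i ⌋ ∧ ⌊ c x k i ℤ.≟ ℤ.+ 0 ⌋ ≡ true → ⊥
    no-k k Pk with unboth (toℕ k <? toℕ i) (c x k i ℤ.≟ ℤ.+ 0) Pk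
    ... | k<i , c0 = ¬o (toℕ k , m≤n⇒m≤1+n k<i , ≤-reflexive (sym (c≡0⇒ k i k<i c0)))

-- Removing the free elements preserves the signature.

ones-add : ∀ (a b c : Seq) i ℓ → (∀ j → i ≤ j → j < i + ℓ → bit (a j) + bit (b j) ≡ bit (c j)) →
  ones a i ℓ + ones b i ℓ ≡ ones c i ℓ
ones-add a b c i zero    eq = refl
ones-add a b c i (suc ℓ) eq = trans (regroup (bit (a i)) _ _ _)
  (cong₂ _+_ (eq i ≤-refl (m<m+n i (s≤s z≤n)))
    (ones-add a b c (suc i) ℓ λ j i<j j<k → eq j (<⇒≤ i<j) (subst (j <_) (sym (+-suc i ℓ)) j<k)))
  where
  regroup : ∀ a b c d → (a + b) + (c + d) ≡ (a + c) + (b + d)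
  regroup = solve-∀

ones-search : ∀ s i ℓ → (∃ λ j → i ≤ j × j < i + ℓ × s j ≡ true) ⊎ ones s i ℓ ≡ 0
ones-search s i zero    = inj₂ refl
ones-search s i (suc ℓ) with s i in si | ones-search s (suc i) ℓ
... | true  | _ = inj₁ (i , ≤-refl , m<m+n i (s≤s z≤n) , si)
... | false | inj₁ (j , i<j , j< , sj) = inj₁ (j , <⇒≤ i<j , subst (j <_) (sym (+-suc i ℓ)) j< , sj)
... | false | inj₂ eq = inj₂ eq

ones-prefix : ∀ s {t t′} → t ≤ t′ → ∃ λ ℓ → t + ℓ ≡ t′ × ones s 0 t′ ≡ ones s 0 t + ones s t ℓ
ones-prefix s {t} t≤t′ with m≤n⇒∃[o]m+o≡n t≤t′
... | ℓ , refl = ℓ , refl , ones-+ s 0 t ℓ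

core : ∀ {n} → Subset n → Subset n
core {n} x = tabulate λ i → lookup x i ∧ not (free (per x) n (toℕ i))

lookup-core : ∀ {n} (x : Subset n) i → lookup (core x) i ≡ lookup x i ∧ not (free (per x) n (toℕ i))
lookup-core x i = lookup∘tabulate _ i

InQ⇒zeros≤ones : ∀ {n} (x : Subset n) → InQ x → zeros (per x) 0 n ≤ ones (per x) 0 n
InQ⇒zeros≤ones {n} x x∈Q = +-cancelˡ-≤ (ones (per x) 0 n) _ _ (begin
  ones (per x) 0 n + zeros (per x) 0 n   ≡⟨ ones+zeros (per x) 0 n ⟩
  n                                      ≤⟨ x∈Q ⟩
  2 * ∣ x ∣                              ≡⟨ cong (2 *_) (∣∣-ones x) ⟩
  2 * ones (per x) 0 n                   ≡⟨ cong (ones (per x) 0 n +_) (+-identityʳ _) ⟩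
  ones (per x) 0 n + ones (per x) 0 n    ∎)
  where open ≤-Reasoning

module CoreFacts {n} (x : Subset n) (x∈Q : InQ x) where

  s : Seq
  s = per x

  m : ℕ
  m = ones s 0 n ∸ zeros s 0 n

  rise : height s n n ≡ height s n 0 + m
  rise = trans (height-end s n) (sym (m+[n∸m]≡n (InQ⇒zeros≤ones x x∈Q)))

  open Linear s n (per-periodic x) m rise public

  zeros+free : zeros s 0 n + ones u 0 n ≡ ∣ x ∣
  zeros+free = trans (cong (zeros s 0 n +_) count-u)
    (trans (sym rise) (trans (height-end s n) (sym (∣∣-ones x))))

  s₀ : Seq
  s₀ = per (core x)

  s₀≡ : ∀ {t} → t < n → s₀ t ≡ s t ∧ not (u t)
  s₀≡ {t} t<n = trans (per-< (core x) t<n) (trans (lookup∘tabulate _ (fromℕ< t<n))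
    (cong₂ (λ b q → b ∧ not (u q)) (sym (per-< x t<n)) (toℕ-fromℕ< t<n)))

  g₀ : ℕ → ℕ
  g₀ = height s₀ n

  f : ℕ → ℕ
  f = ones u 0

  size : ∣ core x ∣ + ones u 0 n ≡ ∣ x ∣
  size = trans (cong (_+ ones u 0 n) (∣∣-ones (core x)))
    (trans (ones-add s₀ u s 0 n λ j _ j<n → trans (cong (λ b → bit b + bit (u j)) (s₀≡ j<n)) (bits (s j) (u j) (free⇒one {s})))
      (sym (∣∣-ones x)))
    where
    bits : ∀ a b → (b ≡ true → a ≡ true) → bit (a ∧ not b) + bit b ≡ bit a
    bits true  true  _ = refl
    bits true  false _ = refl
    bits false true  h with () ← h refl
    bits false false _ = refl

  size-core : ∣ x ∣ + ∣ core x ∣ ≡ n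
  size-core = begin
    ∣ x ∣ + ∣ core x ∣                            ≡⟨ cong (_+ ∣ core x ∣) (sym zeros+free) ⟩
    (zeros s 0 n + ones u 0 n) + ∣ core x ∣       ≡⟨ regroup (zeros s 0 n) _ _ ⟩
    (∣ core x ∣ + ones u 0 n) + zeros s 0 n       ≡⟨ cong (_+ zeros s 0 n) (trans size (∣∣-ones x)) ⟩
    ones s 0 n + zeros s 0 n                      ≡⟨ ones+zeros s 0 n ⟩
    n                                             ∎
    where
    open ≡-Reasoning
    regroup : ∀ a b c → (a + b) + c ≡ (c + b) + a
    regroup = solve-∀

  -- Removing a free element lowers all later heights by 2.
  g₀-g : ∀ t → t ≤ n → g₀ t + 2 * f t + g 0 ≡ g t + g₀ 0
  g₀-g zero    _   = trans (cong (_+ g 0) (+-identityʳ (g₀ 0))) (+-comm (g₀ 0) (g 0))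
  g₀-g (suc t) t<n = +-cancelʳ-≡ (bit (not (s₀ t)) + bit (not (s t))) _ _ (begin
    g₀ (suc t) + 2 * f (suc t) + g 0 + (bit (not (s₀ t)) + bit (not (s t)))
      ≡⟨ rg₁ (g₀ (suc t)) (f (suc t)) (g 0) _ _ ⟩
    (g₀ (suc t) + bit (not (s₀ t))) + 2 * f (suc t) + g 0 + bit (not (s t))
      ≡⟨ cong₂ (λ a b → a + 2 * b + g 0 + bit (not (s t))) (height-step s₀ n t t<n) (ones-snoc u 0 t) ⟩
    (g₀ t + bit (s₀ t)) + 2 * (f t + bit (u t)) + g 0 + bit (not (s t))
      ≡⟨ rg₂ (g₀ t) (bit (s₀ t)) (f t) (bit (u t)) (g 0) (bit (not (s t))) ⟩
    (g₀ t + 2 * f t + g 0) + (bit (s₀ t) + 2 * bit (u t) + bit (not (s t)))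
      ≡⟨ cong₂ _+_ (g₀-g t (<⇒≤ t<n)) balance ⟩
    (g t + g₀ 0) + (bit (not (s₀ t)) + bit (s t))
      ≡⟨ rg₃ (g t) (g₀ 0) _ _ ⟩
    (g t + bit (s t)) + g₀ 0 + bit (not (s₀ t))
      ≡⟨ cong (λ a → a + g₀ 0 + bit (not (s₀ t))) (sym (height-step s n t t<n)) ⟩
    (g (suc t) + bit (not (s t))) + g₀ 0 + bit (not (s₀ t))
      ≡⟨ rg₄ (g (suc t)) _ (g₀ 0) _ ⟩
    g (suc t) + g₀ 0 + (bit (not (s₀ t)) + bit (not (s t))) ∎)
    where
    open ≡-Reasoning
    rg₁ : ∀ a b c d e → a + 2 * b + c + (d + e) ≡ (a + d) + 2 * b + c + e
    rg₁ = solve-∀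
    rg₂ : ∀ a b c d e k → (a + b) + 2 * (c + d) + e + k ≡ (a + 2 * c + e) + (b + 2 * d + k)
    rg₂ = solve-∀
    rg₃ : ∀ a b c d → (a + b) + (c + d) ≡ (a + d) + b + c
    rg₃ = solve-∀
    rg₄ : ∀ a b c d → (a + b) + c + d ≡ a + c + (d + b)
    rg₄ = solve-∀
    bits : ∀ a b → (b ≡ true → a ≡ true) →
      bit (a ∧ not b) + 2 * bit b + bit (not a) ≡ bit (not (a ∧ not b)) + bit a
    bits true  true  _ = refl
    bits true  false _ = refl
    bits false true  h with () ← h refl
    bits false false _ = refl
    balance : bit (s₀ t) + 2 * bit (u t) + bit (not (s t)) ≡ bit (not (s₀ t)) + bit (s t)
    balance rewrite s₀≡ t<n = bits (s t) (u t) (free⇒one {s})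

  g₀-shift : ∀ {t t′} → t ≤ n → t′ ≤ n → g₀ t + 2 * f t + g t′ ≡ g₀ t′ + 2 * f t′ + g t
  g₀-shift {t} {t′} p q = +-cancelʳ-≡ (g 0 + g₀ 0) _ _ (begin
    g₀ t + 2 * f t + g t′ + (g 0 + g₀ 0)      ≡⟨ rg (g₀ t + 2 * f t) (g t′) (g 0) (g₀ 0) ⟩
    (g₀ t + 2 * f t + g 0) + (g t′ + g₀ 0)    ≡⟨ cong₂ _+_ (g₀-g t p) (sym (g₀-g t′ q)) ⟩
    (g t + g₀ 0) + (g₀ t′ + 2 * f t′ + g 0)   ≡⟨ rg′ (g t) (g₀ 0) (g₀ t′ + 2 * f t′) (g 0) ⟩
    g₀ t′ + 2 * f t′ + g t + (g 0 + g₀ 0)     ∎)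
    where
    open ≡-Reasoning
    rg : ∀ a b c d → a + b + (c + d) ≡ (a + c) + (b + d)
    rg = solve-∀
    rg′ : ∀ a b c d → (a + b) + (c + d) ≡ c + a + (d + b)
    rg′ = solve-∀

  -- By `g₀-shift` the heights of `core x` are g - 2f up to a constant. The hypothesis compares g -
  -- 2f at the two points, with the subtractions moved across.
  g₀-≤ : ∀ {t t′} → t ≤ n → t′ ≤ n → g t + 2 * f t′ ≤ g t′ + 2 * f t → g₀ t ≤ g₀ t′
  g₀-≤ {t} {t′} p q le = +-cancelʳ-≤ (2 * f t + g t′) _ _ (begin
    g₀ t + (2 * f t + g t′)     ≡⟨ sym (+-assoc (g₀ t) _ _) ⟩
    g₀ t + 2 * f t + g t′       ≡⟨ g₀-shift p q ⟩
    g₀ t′ + 2 * f t′ + g t      ≡⟨ rg (g₀ t′) _ _ ⟩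
    g₀ t′ + (g t + 2 * f t′)    ≤⟨ +-monoʳ-≤ (g₀ t′) le ⟩
    g₀ t′ + (g t′ + 2 * f t)    ≡⟨ cong (g₀ t′ +_) (+-comm (g t′) _) ⟩
    g₀ t′ + (2 * f t + g t′)    ∎)
    where
    open ≤-Reasoning
    rg : ∀ a b c → a + b + c ≡ a + (c + b)
    rg = solve-∀

  g₀-< : ∀ {t t′} → t ≤ n → t′ ≤ n → f t ≡ f t′ → g t < g t′ → g₀ t < g₀ t′
  g₀-< {t} {t′} p q eq lt = +-cancelʳ-< (2 * f t + g t′) _ _ (begin-strict
    g₀ t + (2 * f t + g t′)     ≡⟨ sym (+-assoc (g₀ t) _ _) ⟩
    g₀ t + 2 * f t + g t′       ≡⟨ g₀-shift p q ⟩
    g₀ t′ + 2 * f t′ + g t      ≡⟨ +-assoc (g₀ t′) _ _ ⟩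
    g₀ t′ + (2 * f t′ + g t)    ≡⟨ cong (λ k → g₀ t′ + (2 * k + g t)) (sym eq) ⟩
    g₀ t′ + (2 * f t + g t)     <⟨ +-monoʳ-< (g₀ t′) (+-monoʳ-< (2 * f t) lt) ⟩
    g₀ t′ + (2 * f t + g t′)    ∎)
    where open ≤-Reasoning

  f-mono : ∀ {t t′} → t ≤ t′ → f t ≤ f t′
  f-mono t≤t′ with ones-prefix u t≤t′
  ... | ℓ , _ , eq = ≤-trans (m≤m+n _ _) (≤-reflexive (sym eq))

  f≤m : ∀ t → t ≤ n → f t ≤ m
  f≤m t t≤n = ≤-trans (f-mono t≤n) (≤-reflexive count-u)

  module Sx = Signature x
  module Sc = Signature (core x)

  -- Both entries are stars: an unmatched one in `x`, an unmatched zero in `core x`. For the latter,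
  -- g - 2f equals μ - f(i) at a free `i` and is at least μ - f(t) elsewhere. As `f` is monotone, no
  -- earlier point is lower than `i`, whereas `suc i` is.
  sg-free : ∀ i → u (toℕ i) ≡ true → sgAt (core x) i ≡ sgAt x i
  sg-free i ui = trans (Sc.sg-¬opened {i} ci ¬op) (sym (Sx.sg-¬closed {i} xi ¬cl))
    where
    i<n : toℕ i < n
    i<n = toℕ<n i
    xi : lookup x i ≡ true
    xi = trans (sym (per-toℕ x i)) (free⇒one {s} ui)
    ci : lookup (core x) i ≡ false
    ci = trans (lookup-core x i) (cong₂ (λ a b → a ∧ not b) xi ui)
    ¬cl : ¬ Sx.Closed i
    ¬cl (t , s≤s t≤n , i<t , le) = <-irrefl refl (<-≤-trans (proj₁ (u-sound (toℕ i) i<n ui) t i<t t≤n) le)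
    ¬op : ¬ Sc.Opened i
    ¬op (t , s≤s t≤i , le) = <-irrefl refl (≤-trans (≤-reflexive (sym (Sc.down {i} ci)))
      (≤-trans (g₀-≤ (<⇒≤ i<n) t≤n (begin
        g (toℕ i) + 2 * f t          ≡⟨ cong (_+ 2 * f t) (sym (count-u-at (toℕ i) i<n ui)) ⟩
        f (toℕ i) + μ + 2 * f t      ≡⟨ rg₁ (f (toℕ i)) μ (f t) ⟩
        f t + μ + (f t + f (toℕ i))  ≤⟨ +-mono-≤ (count-u-≤ t t≤n) (+-monoˡ-≤ (f (toℕ i)) (f-mono t≤i)) ⟩
        g t + (f (toℕ i) + f (toℕ i)) ≡⟨ cong (λ k → g t + (f (toℕ i) + k)) (sym (+-identityʳ _)) ⟩
        g t + 2 * f (toℕ i)          ∎)) le))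
      where
      open ≤-Reasoning
      t≤n : t ≤ n
      t≤n = ≤-trans t≤i (<⇒≤ i<n)
      rg₁ : ∀ a b c → a + b + 2 * c ≡ c + b + (c + a)
      rg₁ = solve-∀

  -- Removing later free elements only lowers a closing point, so a matched one stays matched. An
  -- unmatched one that is not free has height at least `μ + m`; then all `m` free elements precede
  -- it, and the heights from there on are shifted equally.
  sg-one : ∀ i → lookup x i ≡ true → u (toℕ i) ≡ false → sgAt (core x) i ≡ sgAt x i
  sg-one i xi ui with Sx.closed? i
  ... | yes cl@(t , s≤s t≤n , i<t , le) = trans
          (Sc.sg-closed {i} ci (t , s≤s t≤n , i<t ,
            g₀-≤ t≤n (<⇒≤ (toℕ<n i)) (+-mono-≤ le (*-monoʳ-≤ 2 (f-mono (<⇒≤ i<t))))))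
          (sym (Sx.sg-closed {i} xi cl))
    where
    ci : lookup (core x) i ≡ true
    ci = trans (lookup-core x i) (cong₂ (λ a b → a ∧ not b) xi ui)
  ... | no ¬cl = trans (Sc.sg-¬closed {i} ci ¬cl₀) (sym (Sx.sg-¬closed {i} xi ¬cl))
    where
    ci : lookup (core x) i ≡ true
    ci = trans (lookup-core x i) (cong₂ (λ a b → a ∧ not b) xi ui)
    i<n : toℕ i < n
    i<n = toℕ<n i
    high : μ + m ≤ g (toℕ i)
    high with μ + m ≤? g (toℕ i)
    ... | yes le = le
    ... | no nle with () ← trans (sym ui) (u-complete (toℕ i) i<n (Sx.¬closed {i} ¬cl) (≰⇒> nle))
    fi≡m : f (toℕ i) ≡ m
    fi≡m = +-cancelʳ-≡ μ _ _ (trans (count-u-before (toℕ i) (<⇒≤ i<n))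
      (trans (m≥n⇒m⊓n≡n high-low) (+-comm μ m)))
      where
      high-low : μ + m ≤ low g (n ∸ toℕ i) (toℕ i)
      high-low with low-attained g (n ∸ toℕ i) (toℕ i)
      ... | j , i≤j , j≤ , eq with m≤n⇒m<n∨m≡n i≤j
      ... | inj₂ refl = subst (μ + m ≤_) eq high
      ... | inj₁ i<j  = subst (μ + m ≤_) eq (≤-trans high
              (<⇒≤ (Sx.¬closed {i} ¬cl j i<j (subst (j ≤_) (m+[n∸m]≡n (<⇒≤ i<n)) j≤))))
    ¬cl₀ : ¬ Sc.Closed i
    ¬cl₀ (t , s≤s t≤n , i<t , le) = <-irrefl refl (<-≤-trans
      (g₀-< (<⇒≤ i<n) t≤n
        (≤-antisym (f-mono (<⇒≤ i<t)) (≤-trans (f≤m t t≤n) (≤-reflexive (sym fi≡m))))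
        (Sx.¬closed {i} ¬cl t i<t t≤n)) le)

  -- A free `j` before `i` is a last passage, hence lower than `suc i`, and so opens the zero at
  -- `i`. Before an unopened zero there is thus no free element and relative heights are unchanged;
  -- for an opened zero `settle` supplies a witness in `core x`.
  sg-zero : ∀ i → lookup x i ≡ false → sgAt (core x) i ≡ sgAt x i
  sg-zero i xi = go (Sx.opened? i)
    where
    i<n : toℕ i < n
    i<n = toℕ<n i
    ci : lookup (core x) i ≡ false
    ci = trans (lookup-core x i) (cong (_∧ not (u (toℕ i))) xi)
    free-low : ∀ j → j ≤ toℕ i → u j ≡ true → g j < g (suc (toℕ i))
    free-low j j≤i uj = proj₁ (u-sound j (≤-<-trans j≤i i<n) uj) (suc (toℕ i)) (s≤s j≤i) i<n
    -- Moving t past the free elements that separate it from i.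
    settle : ∀ k t → suc (toℕ i) ≤ t + k → g t ≤ g (suc (toℕ i)) → t ≤ toℕ i → Sc.Opened i
    settle zero    t i<t le t≤i = ⊥-elim (<-irrefl refl (≤-trans i<t (≤-trans (≤-reflexive (+-identityʳ t)) t≤i)))
    settle (suc k) t i<  le t≤i with ones-search u t (suc (toℕ i) ∸ t)
    ... | inj₂ none = t , s≤s t≤i , g₀-≤ (≤-trans t≤i (<⇒≤ i<n)) i<n (+-mono-≤ le (*-monoʳ-≤ 2
            (≤-reflexive (begin
              f (suc (toℕ i))                          ≡⟨ cong f (sym split) ⟩
              f (t + (suc (toℕ i) ∸ t))                ≡⟨ ones-+ u 0 t _ ⟩
              f t + ones u t (suc (toℕ i) ∸ t)         ≡⟨ cong (f t +_) none ⟩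
              f t + 0                                  ≡⟨ +-identityʳ (f t) ⟩
              f t                                      ∎))))
      where
      open ≡-Reasoning
      split : t + (suc (toℕ i) ∸ t) ≡ suc (toℕ i)
      split = m+[n∸m]≡n (m≤n⇒m≤1+n t≤i)
    -- `suc j` is again a witness: it is one higher than `j`, and the last passage `j` is strictly
    -- lower than `suc i`. It does not exceed `i`, because `j` carries a one and `i` a zero.
    ... | inj₁ (j , t≤j , j< , uj) = settle k (suc j)
            (≤-trans i< (≤-trans (≤-reflexive (+-suc t k)) (s≤s (+-monoˡ-≤ k t≤j))))
            (≤-trans (≤-reflexive (height-up s n j (<-trans j<i i<n) (free⇒one {s} uj))) (free-low j (<⇒≤ j<i) uj))
            j<i
      where
      j≢i : j ≢ toℕ i
      j≢i refl with () ← trans (sym xi) (trans (sym (per-toℕ x i)) (free⇒one {s} uj))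
      j<i : j < toℕ i
      j<i = ≤∧≢⇒< (≤-pred (subst (j <_) (m+[n∸m]≡n (m≤n⇒m≤1+n t≤i)) j<)) j≢i
    go : Dec (Sx.Opened i) → sgAt (core x) i ≡ sgAt x i
    go (yes op@(t , s≤s t≤i , le)) = trans
      (Sc.sg-opened {i} ci (settle (suc (toℕ i)) t (m≤n+m _ t) le t≤i)) (sym (Sx.sg-opened {i} xi op))
    go (no ¬op) = trans (Sc.sg-¬opened {i} ci ¬op₀) (sym (Sx.sg-¬opened {i} xi ¬op))
      where
      none : ∀ t → t ≤ suc (toℕ i) → f t ≡ 0
      none t t≤ with ones-search u 0 t
      ... | inj₂ eq = eq
      ... | inj₁ (j , _ , j<t , uj) = ⊥-elim (<-asym (free-low j j≤i uj) (Sx.¬opened {i} ¬op j j≤i))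
        where
        j≤i : j ≤ toℕ i
        j≤i = ≤-pred (<-≤-trans j<t t≤)
      ¬op₀ : ¬ Sc.Opened i
      ¬op₀ (t , s≤s t≤i , le) = <-irrefl refl (<-≤-trans
        (g₀-< i<n (≤-trans t≤i (<⇒≤ i<n)) (trans (none _ ≤-refl) (sym (none t (m≤n⇒m≤1+n t≤i))))
          (Sx.¬opened {i} ¬op t t≤i)) le)

  sg-core : sg (core x) ≡ sg x
  sg-core = tabulate-cong λ i → pick i (lookup x i) refl (u (toℕ i)) refl
    where
    pick : ∀ i b → lookup x i ≡ b → ∀ b′ → u (toℕ i) ≡ b′ → sgAt (core x) i ≡ sgAt x i
    pick i _     _  true  ui = sg-free i ui
    pick i true  xi false ui = sg-one i xi ui
    pick i false xi false ui = sg-zero i xi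

-- Signature and size determine a set; identification of `p` with `core`.

∈⇒true : ∀ {n} {x : Subset n} {i} → i ∈ x → lookup x i ≡ true
∈⇒true = []=⇒lookup

true⇒∈ : ∀ {n} {x : Subset n} {i} → lookup x i ≡ true → i ∈ x
true⇒∈ {x = x} {i} = lookup⇒[]= i x

⊆-or-extra : ∀ {n} (x y : Subset n) → x ⊆ y ⊎ ∃ λ i → lookup x i ≡ true × lookup y i ≡ false
⊆-or-extra x y with any? (λ i → (lookup x i Bool.≟ true) ×-dec (lookup y i Bool.≟ false))
... | yes w = inj₂ w
... | no ¬w = inj₁ λ {i} i∈x → true⇒∈ (¬-not λ yi → ¬w (i , ∈⇒true i∈x , yi))

⊆-∣∣⇒≡ : ∀ {n} {x y : Subset n} → x ⊆ y → ∣ x ∣ ≡ ∣ y ∣ → x ≡ y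
⊆-∣∣⇒≡ {x = x} {y} x⊆y eq with ⊆-or-extra y x
... | inj₁ y⊆x = ⊆-antisym x⊆y y⊆x
... | inj₂ (i , yi , xi) = ⊥-elim (<-irrefl eq (p⊂q⇒∣p∣<∣q∣
        (x⊆y , i , true⇒∈ yi , λ i∈x → contradiction (trans (sym (∈⇒true i∈x)) xi) λ ())))

sg-at : ∀ {n} (x y : Subset n) → sg x ≡ sg y → ∀ i → sgAt x i ≡ sgAt y i
sg-at x y eq i = trans (sym (lookup∘tabulate (sgAt x) i))
  (trans (cong (λ v → lookup v i) eq) (lookup∘tabulate (sgAt y) i))

-- `s1` occurs only at ones and `s0` only at zeros, so where the bits differ the common entry must
-- be `s*`.
stars : ∀ {n} (x y : Subset n) {i} → sgAt x i ≡ sgAt y i → lookup x i ≡ true → lookup y i ≡ false →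
  ¬ Signature.Closed x i × ¬ Signature.Opened y i
stars x y {i} eq xi yi with Signature.closed? x i | Signature.opened? y i
... | yes cl | yes op with () ← trans (sym (Signature.sg-closed x {i} xi cl)) (trans eq (Signature.sg-opened y {i} yi op))
... | yes cl | no ¬op with () ← trans (sym (Signature.sg-closed x {i} xi cl)) (trans eq (Signature.sg-¬opened y {i} yi ¬op))
... | no ¬cl | yes op with () ← trans (sym (Signature.sg-¬closed x {i} xi ¬cl)) (trans eq (Signature.sg-opened y {i} yi op))
... | no ¬cl | no ¬op = ¬cl , ¬op

-- Among the starred positions a 1 is never followed by a 0.
star-order : ∀ {n} (x : Subset n) {i j} → ¬ Signature.Closed x i → ¬ Signature.Opened x j → ¬ (toℕ i < toℕ j)
star-order x {i} {j} ¬cl ¬op i<j = <-asym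
  (Signature.¬closed x {i} ¬cl (suc (toℕ j)) (m≤n⇒m≤1+n i<j) (toℕ<n j))
  (Signature.¬opened x {j} ¬op (toℕ i) (<⇒≤ i<j))

-- Otherwise each set has an element that the other lacks. Both positions are starred, and in either
-- order of the two positions one of the sets has a starred one before a starred zero, against
-- `star-order`.
sg-∣∣-injective : ∀ {n} (x y : Subset n) → sg x ≡ sg y → ∣ x ∣ ≡ ∣ y ∣ → x ≡ y
sg-∣∣-injective x y eq size with ⊆-or-extra x y | ⊆-or-extra y x
... | inj₁ x⊆y | _ = ⊆-∣∣⇒≡ x⊆y size
... | inj₂ _ | inj₁ y⊆x = sym (⊆-∣∣⇒≡ y⊆x (sym size))
... | inj₂ (i , xi , yi) | inj₂ (j , yj , xj)
  with stars x y (sg-at x y eq i) xi yi | stars y x (sg-at y x (sym eq) j) yj xj | <-cmp (toℕ i) (toℕ j)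
... | ¬cl , _ | _ , ¬op | tri< i<j _ _ = ⊥-elim (star-order x {i} {j} ¬cl ¬op i<j)
... | _ , ¬op | ¬cl , _ | tri> _ _ j<i = ⊥-elim (star-order y {j} {i} ¬cl ¬op j<i)
... | _ | _ | tri≈ _ i≡j _ with toℕ-injective i≡j
... | refl with () ← trans (sym xi) xj

∈-allSubsets : ∀ {n} (x : Subset n) → x ∈ˡ allSubsets n
∈-allSubsets []          = here refl
∈-allSubsets (false ∷ x) = ∈-++⁺ˡ (∈-map⁺ (false ∷_) (∈-allSubsets x))
∈-allSubsets {suc n} (true ∷ x) = ∈-++⁺ʳ (L.map (false ∷_) (allSubsets n)) (∈-map⁺ (true ∷_) (∈-allSubsets x))

pSearch-finds : ∀ {n} (x z : Subset n) zs → z ∈ˡ zs → sg z ≡ sg x → ∣ x ∣ + ∣ z ∣ ≡ n →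
  sg (pSearch x zs) ≡ sg x × ∣ x ∣ + ∣ pSearch x zs ∣ ≡ n
pSearch-finds {n} x z (w L.∷ zs) z∈ sz nz with ≡-dec _≟S_ (sg w) (sg x) | ∣ x ∣ + ∣ w ∣ ≟ n
... | yes sw | yes nw = sw , nw
pSearch-finds x z (w L.∷ zs) (there z∈) sz nz | yes _ | no _ = pSearch-finds x z zs z∈ sz nz
pSearch-finds x z (w L.∷ zs) (there z∈) sz nz | no _  | _    = pSearch-finds x z zs z∈ sz nz
pSearch-finds x z (z L.∷ zs) (here refl) sz nz | yes _ | no ¬nw = ⊥-elim (¬nw nz)
pSearch-finds x z (z L.∷ zs) (here refl) sz nz | no ¬sw | _ = ⊥-elim (¬sw sz)

-- The search result and `core x` share the signature of `x` and the size n - |x|, which leaves only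
-- one set.
p≡core : ∀ {n} (x : Subset n) → InQ x → p x ≡ core x
p≡core {n} x x∈Q with pSearch-finds x (core x) (allSubsets n) (∈-allSubsets _) (CoreFacts.sg-core x x∈Q) (CoreFacts.size-core x x∈Q)
... | sgp , np = sg-∣∣-injective _ _ (trans sgp (sym (CoreFacts.sg-core x x∈Q)))
      (+-cancelˡ-≡ ∣ x ∣ _ _ (trans np (sym (CoreFacts.size-core x x∈Q))))

-- The order as membership in an interval, and one-element changes.

∈-core⁻ : ∀ {n} (x : Subset n) {i} → i ∈ core x → lookup x i ≡ true × free (per x) n (toℕ i) ≡ false
∈-core⁻ {n} x {i} i∈ with lookup x i | free (per x) n (toℕ i) | trans (sym (lookup-core x i)) (∈⇒true i∈)
... | true | false | _ = refl , refl

∈-core⁺ : ∀ {n} (x : Subset n) {i} → lookup x i ≡ true → free (per x) n (toℕ i) ≡ false → i ∈ core x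
∈-core⁺ x {i} xi fi = true⇒∈ (trans (lookup-core x i) (cong₂ (λ a b → a ∧ not b) xi fi))

core⊆ : ∀ {n} (x : Subset n) → core x ⊆ x
core⊆ x i∈ = true⇒∈ (proj₁ (∈-core⁻ x i∈))

⊆⇒⊑ : ∀ {n} {y x : Subset n} → y ⊆ x → per y ⊑ per x
⊆⇒⊑ {suc n} y⊆x i yi = ∈⇒true (y⊆x (true⇒∈ yi))

pos-mono : ∀ {s s′ n i} → s ⊑ s′ → Pos s n i → Pos s′ n i
pos-mono {i = i} h P ℓ p q = ≤-<-trans (zeros-mono h i ℓ) (<-≤-trans (P ℓ p q) (ones-mono h i ℓ))

Fin⇒0< : ∀ {n} → Fin n → 0 < n
Fin⇒0< {suc n} _ = s≤s z≤n

core-antitone : ∀ {n} {y x : Subset n} → y ⊆ x → core x ⊆ y → core x ⊆ core y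
core-antitone {n} {y} {x} y⊆x cx⊆y {i} i∈ with free (per y) n (toℕ i) in fy
... | false = ∈-core⁺ y (∈⇒true (cx⊆y i∈)) fy
... | true with () ← trans (sym (pos⇒free {per x} (Fin⇒0< i) (pos-mono (⊆⇒⊑ y⊆x) (free⇒pos {per y} fy)))) (proj₂ (∈-core⁻ x i∈))

≺⇒⊆ : ∀ {n} {y x : Subset n} → InQ x → y ≺ x → core x ⊆ y × y ⊆ x
≺⇒⊆ {y = y} {x} x∈Q (_ , px⊆py , py⊆y , y⊆x) = subst (_⊆ y) (p≡core x x∈Q) (⊆-trans px⊆py py⊆y) , y⊆x

⊆⇒≺ : ∀ {n} {y x : Subset n} → InQ y → InQ x → y ≢ x → core x ⊆ y → y ⊆ x → y ≺ x
⊆⇒≺ {y = y} {x} y∈Q x∈Q y≢x cx⊆y y⊆x =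
  y≢x , subst₂ _⊆_ (sym (p≡core x x∈Q)) (sym (p≡core y y∈Q)) (core-antitone y⊆x cx⊆y) ,
  subst (_⊆ y) (sym (p≡core y y∈Q)) (core⊆ y) , y⊆x

∣add∣ : ∀ {n} (y : Subset n) a → lookup y a ≡ false → ∣ y [ a ]≔ true ∣ ≡ suc ∣ y ∣
∣add∣ (false ∷ y) zero    refl = refl
∣add∣ (true  ∷ y) (suc a) ya   = cong suc (∣add∣ y a ya)
∣add∣ (false ∷ y) (suc a) ya   = ∣add∣ y a ya

∣remove∣ : ∀ {n} (x : Subset n) a → lookup x a ≡ true → suc ∣ x [ a ]≔ false ∣ ≡ ∣ x ∣
∣remove∣ (true  ∷ x) zero    refl = refl
∣remove∣ (true  ∷ x) (suc a) xa   = cong suc (∣remove∣ x a xa)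
∣remove∣ (false ∷ x) (suc a) xa   = ∣remove∣ x a xa

lookup-update : ∀ {n} (x : Subset n) a b i → (i ≡ a × lookup (x [ a ]≔ b) i ≡ b) ⊎ (i ≢ a × lookup (x [ a ]≔ b) i ≡ lookup x i)
lookup-update x a b i with i Data.Fin.≟ a
... | yes refl = inj₁ (refl , lookup∘update i x b)
... | no i≢a   = inj₂ (i≢a , lookup∘update′ i≢a x b)

⊆-add : ∀ {n} (y : Subset n) a → y ⊆ y [ a ]≔ true
⊆-add y a {i} i∈y with lookup-update y a true i
... | inj₁ (_ , eq) = true⇒∈ eq
... | inj₂ (_ , eq) = true⇒∈ (trans eq (∈⇒true i∈y))

remove-⊆ : ∀ {n} (x : Subset n) a → x [ a ]≔ false ⊆ x
remove-⊆ x a {i} i∈ with lookup-update x a false i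
... | inj₁ (_ , eq) with () ← trans (sym (∈⇒true i∈)) eq
... | inj₂ (_ , eq) = true⇒∈ (trans (sym eq) (∈⇒true i∈))

add-⊆ : ∀ {n} {y x : Subset n} {a} → y ⊆ x → lookup x a ≡ true → y [ a ]≔ true ⊆ x
add-⊆ {y = y} {x} {a} y⊆x xa {i} i∈ with lookup-update y a true i
... | inj₁ (refl , _) = true⇒∈ xa
... | inj₂ (_ , eq) = y⊆x (true⇒∈ (trans (sym eq) (∈⇒true i∈)))

core-add-⊆ : ∀ {n} (y : Subset n) a → free (per (y [ a ]≔ true)) n (toℕ a) ≡ true → core (y [ a ]≔ true) ⊆ y
core-add-⊆ y a fa {i} i∈ with lookup-update y a true i | ∈-core⁻ (y [ a ]≔ true) i∈
... | inj₁ (refl , _) | _ , fi with () ← trans (sym fa) fi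
... | inj₂ (_ , eq) | zi , _ = true⇒∈ (trans (sym eq) zi)

core-⊆-remove : ∀ {n} (x : Subset n) a → free (per x) n (toℕ a) ≡ true → core x ⊆ x [ a ]≔ false
core-⊆-remove x a fa {i} i∈ with lookup-update x a false i | ∈-core⁻ x i∈
... | inj₁ (refl , _) | _ , fi with () ← trans (sym fa) fi
... | inj₂ (_ , eq) | xi , _ = true⇒∈ (trans eq xi)

≺-add : ∀ {n} (y : Subset n) a → InQ y → lookup y a ≡ false →
  free (per (y [ a ]≔ true)) n (toℕ a) ≡ true → y ≺ (y [ a ]≔ true)
≺-add y a y∈Q ya fa = ⊆⇒≺ y∈Q (≤-trans y∈Q (*-monoʳ-≤ 2 (p⊆q⇒∣p∣≤∣q∣ (⊆-add y a))))
  (λ y≡z → 1+n≢n (trans (sym (∣add∣ y a ya)) (cong ∣_∣ (sym y≡z)))) (core-add-⊆ y a fa) (⊆-add y a)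

≺-trans : ∀ {n} {x y z : Subset n} → x ≺ y → y ≺ z → x ≺ z
≺-trans (x≢y , py⊆px , px⊆x , x⊆y) (_ , pz⊆py , _ , y⊆z) =
  (λ { refl → x≢y (⊆-antisym x⊆y y⊆z) }) , ⊆-trans pz⊆py py⊆px , px⊆x , ⊆-trans x⊆y y⊆z

-- Cyclic indices and the freeness of an added element.

mod-apart : ∀ {j q n} .{{_ : NonZero n}} → j < q → q < j + n → q % n ≢ j % n
mod-apart {j} {q} {n} j<q q<j+n eq = <-irrefl refl (<-≤-trans q<j+n (begin
  j + n                        ≡⟨ cong (_+ n) (m≡m%n+[m/n]*n j n) ⟩
  j % n + j / n * n + n        ≡⟨ rg (j % n) (j / n * n) n ⟩
  j % n + suc (j / n) * n      ≤⟨ +-monoʳ-≤ (j % n) (*-monoˡ-≤ n j/n<q/n) ⟩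
  j % n + q / n * n            ≡⟨ cong (_+ q / n * n) (sym eq) ⟩
  q % n + q / n * n            ≡⟨ sym (m≡m%n+[m/n]*n q n) ⟩
  q                            ∎))
  where
  open ≤-Reasoning
  rg : ∀ a b c → a + b + c ≡ a + (c + b)
  rg = solve-∀
  j/n<q/n : j / n < q / n
  j/n<q/n = *-cancelʳ-< n _ _ (+-cancelˡ-< (j % n) _ _ (subst₂ _<_ (m≡m%n+[m/n]*n j n)
    (trans (m≡m%n+[m/n]*n q n) (cong (_+ q / n * n) eq)) j<q))

per-cong : ∀ {n} (x : Subset (suc n)) i j → i % suc n ≡ j % suc n → per x i ≡ per x j
per-cong {n} x i j eq = cong (lookup x) (toℕ-injective (trans (toℕ-mod i (suc n)) (trans eq (sym (toℕ-mod j (suc n))))))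

window-mod : ∀ {n} (x : Subset (suc n)) i ℓ →
  ones (per x) i ℓ ≡ ones (per x) (i % suc n) ℓ × zeros (per x) i ℓ ≡ zeros (per x) (i % suc n) ℓ
window-mod {n} x i ℓ =
  trans (cong (λ k → ones (per x) k ℓ) (m≡m%n+[m/n]*n i (suc n))) (ones-shift _ (i % suc n) ℓ periodic) ,
  trans (cong (λ k → zeros (per x) k ℓ) (m≡m%n+[m/n]*n i (suc n))) (zeros-shift _ (i % suc n) ℓ periodic)
  where
  periodic : ∀ j → per x (j + i / suc n * suc n) ≡ per x j
  periodic j = per-cong x (j + i / suc n * suc n) j ([m+kn]%n≡m%n j (i / suc n) (suc n))

pos-mod : ∀ {n} (x : Subset (suc n)) {i j} → i % suc n ≡ j % suc n → Pos (per x) (suc n) i → Pos (per x) (suc n) j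
pos-mod {n} x {i} {j} eq P ℓ p q = subst₂ _<_
  (trans (proj₂ (window-mod x i ℓ)) (trans (cong (λ k → zeros (per x) k ℓ) eq) (sym (proj₂ (window-mod x j ℓ)))))
  (trans (proj₁ (window-mod x i ℓ)) (trans (cong (λ k → ones (per x) k ℓ) eq) (sym (proj₁ (window-mod x j ℓ)))))
  (P ℓ p q)

per-update-same : ∀ {n} (y : Subset (suc n)) j b → per (y [ j mod suc n ]≔ b) j ≡ b
per-update-same {n} y j b = lookup∘update (j mod suc n) y b

per-update-other : ∀ {n} (y : Subset (suc n)) j b q → q % suc n ≢ j % suc n →
  per (y [ j mod suc n ]≔ b) q ≡ per y q
per-update-other {n} y j b q neq = lookup∘update′
  (λ eq → neq (trans (sym (toℕ-mod q (suc n))) (trans (cong toℕ eq) (toℕ-mod j (suc n))))) y b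

-- A window of length below the period that starts after `j` stops before the next copy of `j`, so
-- it does not see the change.
opn-update : ∀ {n} (y : Subset (suc n)) j b → Opn (per y) (suc n) j → Opn (per (y [ j mod suc n ]≔ b)) (suc n) j
opn-update {n} y j b op {ℓ} ℓ<n = subst₂ _≤_ (zeros-cong (suc j) ℓ agree) (ones-cong (suc j) ℓ agree) (op ℓ<n)
  where
  agree : ∀ q → suc j ≤ q → q < suc j + ℓ → per y q ≡ per (y [ j mod suc n ]≔ b) q
  agree q j<q q< = sym (per-update-other y j b q (mod-apart j<q
    (≤-trans q< (≤-trans (≤-reflexive (sym (+-suc j ℓ))) (+-monoʳ-≤ j ℓ<n)))))

toℕ-mod-% : ∀ j n .{{_ : NonZero n}} → toℕ (j mod n) % n ≡ j % n
toℕ-mod-% j n = trans (m<n⇒m%n≡m (toℕ<n (j mod n))) (toℕ-mod j n)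

pos-add : ∀ {n} (y : Subset (suc n)) j → Opn (per y) (suc n) j → Pos (per (y [ j mod suc n ]≔ true)) (suc n) j
pos-add {n} y j op = pos {per (y [ j mod suc n ]≔ true)} (per-update-same y j true) (opn-update y j true op)

free-add : ∀ {n} (y : Subset (suc n)) j → Opn (per y) (suc n) j →
  free (per (y [ j mod suc n ]≔ true)) (suc n) (toℕ (j mod suc n)) ≡ true
free-add {n} y j op = pos⇒free {per (y [ j mod suc n ]≔ true)} (s≤s z≤n)
  (pos-mod (y [ j mod suc n ]≔ true) (sym (toℕ-mod-% j (suc n))) (pos-add y j op))

opn-within : ∀ {n} (y : Subset n) → InQ y → ∀ t → t < n → ∃ λ d → d < n × Opn (per y) n (t + d)
opn-within {suc n} y y∈Q t t<n with CoreFacts.opn-exists y y∈Q (s≤s z≤n)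
... | i , i<n , op with t ≤? i
... | yes t≤i = i ∸ t , ≤-<-trans (m∸n≤m i t) i<n , subst (Opn (per y) (suc n)) (sym (m+[n∸m]≡n t≤i)) op
-- The index found lies before `t`; its copy in the next period is taken.
... | no t≰i  = (i + suc n) ∸ t , d< , subst (Opn (per y) (suc n)) (sym (m+[n∸m]≡n t≤)) op′
  where
  i<t : i < t
  i<t = ≰⇒> t≰i
  t≤ : t ≤ i + suc n
  t≤ = ≤-trans (<⇒≤ t<n) (m≤n+m _ i)
  d< : (i + suc n) ∸ t < suc n
  d< = +-cancelˡ-< t _ _ (subst (_< t + suc n) (sym (m+[n∸m]≡n t≤)) (+-monoˡ-< (suc n) i<t))
  op′ : Opn (per y) (suc n) (i + suc n)
  op′ {ℓ} ℓ<n = subst₂ _≤_ (sym (zeros-shift (suc n) (suc i) ℓ (per-periodic y)))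
    (sym (ones-shift (suc n) (suc i) ℓ (per-periodic y))) (op ℓ<n)

least : ∀ {P : ℕ → Set} → Decidable P → ∀ k → P k → ∃ λ d → d ≤ k × P d × (∀ e → e < d → ¬ P e)
least P? zero    Pk = 0 , z≤n , Pk , λ _ ()
least {P} P? (suc k) Pk with P? 0
... | yes P0 = 0 , z≤n , P0 , λ _ ()
... | no ¬P0 with least {P ∘ suc} (P? ∘ suc) k Pk
... | d , d≤k , Pd , below = suc d , s≤s d≤k , Pd , λ { zero _ → ¬P0 ; (suc e) (s≤s e<d) → below e e<d }

-- The last element of x \ y before an Opn point of y is itself Opn, since in between x and y agree.
cover-step : ∀ {n} (y x : Subset n) → InQ y → core x ⊆ y → y ⊆ x → y ≢ x →
  ∃ λ a → lookup x a ≡ true × lookup y a ≡ false × free (per (y [ a ]≔ true)) n (toℕ a) ≡ true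
cover-step {zero}  [] [] _ _ _ y≢x = ⊥-elim (y≢x refl)
cover-step {suc n} y x y∈Q cx⊆y y⊆x y≢x with ⊆-or-extra x y
... | inj₁ x⊆y = ⊥-elim (y≢x (⊆-antisym y⊆x x⊆y))
... | inj₂ (t , xt , yt) with opn-within y y∈Q (toℕ t) (toℕ<n t)
-- `e` counts backwards from the `Opn` index `A`. The search succeeds because `e = d` leads back to
-- `t`, where `x` and `y` differ.
... | d , d<n , op with least {λ e → per x (A ∸ e) ≡ true × per y (A ∸ e) ≡ false}
        (λ e → (per x (A ∸ e) Bool.≟ true) ×-dec (per y (A ∸ e) Bool.≟ false)) d here′
  where
  A = toℕ t + d
  here′ : per x (A ∸ d) ≡ true × per y (A ∸ d) ≡ false
  here′ rewrite m+n∸n≡m (toℕ t) d = trans (per-toℕ x t) xt , trans (per-toℕ y t) yt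
... | e , e≤d , (xb , yb) , after = b mod suc n , xb , yb , free-add y b op-b
  where
  A b : ℕ
  A = toℕ t + d
  b = A ∸ e
  e≤A : e ≤ A
  e≤A = ≤-trans e≤d (m≤n+m d (toℕ t))
  b+e : b + e ≡ A
  b+e = m∸n+n≡m e≤A
  -- `b` is in `x` but not in `y`, hence not in `core x`.
  b-free : free (per x) (suc n) (toℕ (b mod suc n)) ≡ true
  b-free with free (per x) (suc n) (toℕ (b mod suc n)) in eq
  ... | true = refl
  ... | false with () ← trans (sym (∈⇒true (cx⊆y (∈-core⁺ x {b mod suc n} xb eq)))) yb
  op-x : Opn (per x) (suc n) b
  op-x = pos⇒opn {per x} (s≤s z≤n) (pos-mod x (toℕ-mod-% b (suc n)) (free⇒pos {per x} b-free))
  agree : ∀ q → suc b ≤ q → q ≤ A → per x q ≡ per y q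
  agree q b<q q≤A with per x q in xq | per y q in yq
  ... | true  | true  = refl
  ... | false | false = refl
  ... | true  | false = ⊥-elim (after (A ∸ q)
          (+-cancelˡ-< b _ _ (<-≤-trans (+-monoˡ-< (A ∸ q) b<q) (≤-reflexive (trans (m+[n∸m]≡n q≤A) (sym b+e)))))
          (trans (cong (per x) (m∸[m∸n]≡n q≤A)) xq , trans (cong (per y) (m∸[m∸n]≡n q≤A)) yq))
  ... | false | true with () ← trans (sym (⊆⇒⊑ y⊆x q yq)) xq
  nonneg : ∀ ℓ → ℓ ≤ e → ℓ ≤ n → zeros (per y) (suc b) ℓ ≤ ones (per y) (suc b) ℓ
  nonneg ℓ ℓ≤e ℓ≤n = subst₂ _≤_ (zeros-cong (suc b) ℓ agree′) (ones-cong (suc b) ℓ agree′) (op-x (s≤s ℓ≤n))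
    where
    agree′ : ∀ q → suc b ≤ q → q < suc b + ℓ → per x q ≡ per y q
    agree′ q p q< = agree q p (≤-trans (≤-pred q<) (≤-trans (+-monoʳ-≤ b ℓ≤e) (≤-reflexive b+e)))
  op-b : Opn (per y) (suc n) b
  op-b {ℓ} (s≤s ℓ≤n) with ℓ ≤? e
  ... | yes ℓ≤e = nonneg ℓ ℓ≤e ℓ≤n
  ... | no ℓ≰e with m≤n⇒∃[o]m+o≡n (<⇒≤ (≰⇒> ℓ≰e))
  -- A longer window splits at `A`: up to there `y` agrees with `x`, in which `b` is free, and from
  -- there on `A` is `Opn` for `y`.
  ... | k , refl = subst₂ _≤_ (sym (ones-+ (not ∘ per y) (suc b) e k)) (sym (ones-+ (per y) (suc b) e k))
        (+-mono-≤ (nonneg e ≤-refl (≤-trans (m≤m+n e k) ℓ≤n))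
          (subst (λ j → zeros (per y) (suc j) k ≤ ones (per y) (suc j) k) (sym b+e)
            (op (s≤s (≤-trans (m≤n+m k e) ℓ≤n)))))

-- The grading by size.

halves : ∀ {n k} → n ≤ 2 * k → 2 * k ≤ suc n → k ≡ ⌈ n /2⌉
halves {n} {k} n≤ ≤n rewrite +-identityʳ k = ≤-antisym
  (≤-trans (≤-reflexive (n≡⌊n+n/2⌋ k)) (⌊n/2⌋-mono ≤n))
  (≤-trans (⌈n/2⌉-mono n≤) (≤-reflexive (sym (n≡⌈n+n/2⌉ k))))

graded : ∀ n → IsGradedWithSizeLevels n
graded n = irrefl , transitive , covers , minimal
  where
  irrefl : ∀ x → InQ x → ¬ (x ≺ x)
  irrefl x _ (x≢x , _) = x≢x refl

  transitive : ∀ x y z → InQ x → InQ y → InQ z → x ≺ y → y ≺ z → x ≺ z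
  transitive _ _ _ _ _ _ = ≺-trans

  covers : ∀ x y → InQ x → InQ y → y ≺ x → (∀ z → InQ z → ¬ (y ≺ z × z ≺ x)) → ∣ x ∣ ≡ suc ∣ y ∣
  covers x y x∈Q y∈Q y≺x none with ≺⇒⊆ x∈Q y≺x
  ... | cx⊆y , y⊆x with cover-step y x y∈Q cx⊆y y⊆x (proj₁ y≺x)
  ... | a , xa , ya , fa with ≡-dec Bool._≟_ (y [ a ]≔ true) x
  ... | yes z≡x = trans (cong ∣_∣ (sym z≡x)) (∣add∣ y a ya)
  ... | no z≢x  = ⊥-elim (none z z∈Q
        ( ≺-add y a y∈Q ya fa
        , ⊆⇒≺ z∈Q x∈Q z≢x (⊆-trans cx⊆y (⊆-add y a)) (add-⊆ y⊆x xa)))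
    where
    z = y [ a ]≔ true
    z∈Q : InQ z
    z∈Q = ≤-trans y∈Q (*-monoʳ-≤ 2 (p⊆q⇒∣p∣≤∣q∣ (⊆-add y a)))

  -- Without free elements `core x` is `x`, and the sizes give 2|x| = n. Otherwise deleting a free
  -- element gives a set that minimality forces out of Q, so 2|x| ≤ n + 1.
  minimal : ∀ x → InQ x → (∀ y → InQ y → ¬ (y ≺ x)) → ∣ x ∣ ≡ ⌈ n /2⌉
  minimal x x∈Q none with ⊆-or-extra x (core x)
  ... | inj₁ x⊆c = halves x∈Q (m≤n⇒m≤1+n (begin
    2 * ∣ x ∣             ≡⟨ cong (∣ x ∣ +_) (+-identityʳ ∣ x ∣) ⟩
    ∣ x ∣ + ∣ x ∣         ≤⟨ +-monoʳ-≤ ∣ x ∣ (p⊆q⇒∣p∣≤∣q∣ x⊆c) ⟩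
    ∣ x ∣ + ∣ core x ∣    ≡⟨ CoreFacts.size-core x x∈Q ⟩
    n                     ∎))
    where open ≤-Reasoning
  ... | inj₂ (a , xa , ca) with n ≤? 2 * ∣ x [ a ]≔ false ∣
  ... | yes y∈Q = ⊥-elim (none y y∈Q (⊆⇒≺ y∈Q x∈Q
          (λ y≡x → 1+n≢n (trans (∣remove∣ x a xa) (cong ∣_∣ (sym y≡x))))
          (core-⊆-remove x a fa) (remove-⊆ x a)))
    where
    y = x [ a ]≔ false
    fa : free (per x) n (toℕ a) ≡ true
    fa with free (per x) n (toℕ a) in eq
    ... | true  = refl
    ... | false with () ← trans (sym ca) (∈⇒true (∈-core⁺ x {a} xa eq))
  ... | no y∉Q = halves x∈Q (begin
    2 * ∣ x ∣                        ≡⟨ cong (2 *_) (sym (∣remove∣ x a xa)) ⟩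
    2 * suc ∣ x [ a ]≔ false ∣       ≡⟨ *-suc 2 ∣ x [ a ]≔ false ∣ ⟩
    2 + 2 * ∣ x [ a ]≔ false ∣       ≤⟨ s≤s (≰⇒> y∉Q) ⟩
    suc n                            ∎)
    where open ≤-Reasoning

-- Moving tokens to covers.

record Reach {n} (y : Subset (suc n)) (t d : ℕ) : Set where
  field
    d<n   : d < suc n
    opn   : Opn (per y) (suc n) (t + d)
    first : ∀ e → e < d → ¬ Opn (per y) (suc n) (t + e)
    out   : per y (t + d) ≡ false

  target : Fin (suc n)
  target = (t + d) mod suc n

  cover : Subset (suc n)
  cover = y [ target ]≔ true

  pos-end : Pos (per cover) (suc n) (t + d)
  pos-end = pos-add y (t + d) opn

  -- If such an element of the cover were free, its predecessor would already be `Opn` in `y`,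
  -- contradicting `first`.
  no-pos-between : ∀ {u} → t < u → u < t + d → ¬ Pos (per cover) (suc n) u
  no-pos-between {suc u} (s≤s t≤u) u<A P = first (u ∸ t)
    (+-cancelˡ-< t _ _ (subst (_< t + d) (sym (m+[n∸m]≡n t≤u)) (<-trans (n<1+n u) u<A)))
    (subst (Opn (per y) (suc n)) (sym (m+[n∸m]≡n t≤u)) opn-u)
    where
    A = t + d
    same : ∀ q → suc u ≤ q → q < A → per cover q ≡ per y q
    same q u<q q<A = per-update-other y A true q λ eq →
      mod-apart q<A (≤-trans (+-monoʳ-< t d<n) (+-monoˡ-≤ (suc n) (≤-trans t≤u (<⇒≤ u<q)))) (sym eq)
    positive : ∀ ℓ → 0 < ℓ → ℓ ≤ suc n → suc u + ℓ ≤ A → zeros (per y) (suc u) ℓ < ones (per y) (suc u) ℓ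
    positive ℓ 0<ℓ ℓ≤n ≤A = subst₂ _<_ (zeros-cong (suc u) ℓ same′) (ones-cong (suc u) ℓ same′) (P ℓ 0<ℓ ℓ≤n)
      where
      same′ : ∀ q → suc u ≤ q → q < suc u + ℓ → per cover q ≡ per y q
      same′ q p q< = same q p (<-≤-trans q< ≤A)
    opn-u : Opn (per y) (suc n) u
    opn-u {zero}  ℓ<n = z≤n
    opn-u {suc ℓ} ℓ<n with suc u + suc ℓ ≤? A
    ... | yes ≤A = <⇒≤ (positive (suc ℓ) (s≤s z≤n) (<⇒≤ ℓ<n) ≤A)
    ... | no ≰A with m≤n⇒∃[o]m+o≡n (<⇒≤ u<A)
    ... | r , u+r with m≤n⇒∃[o]m+o≡n (+-cancelˡ-≤ (suc u) r ℓ (≤-trans (≤-reflexive u+r) (≤-pred (subst (A <_) (+-suc (suc u) ℓ) (≰⇒> ≰A)))))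
    -- For a window running past `A`, the zero of `y` at `A` is paid for by the positive surplus
    -- before it, and the part after `A` is nonnegative by `opn`.
    ... | k , refl = subst₂ (λ z o → z ≤ o) (sym (split (not ∘ per y))) (sym (split (per y))) (begin
        zeros (per y) (suc u) r + (bit (not (per y A)) + zeros (per y) (suc A) k)
          ≡⟨ cong (λ b → zeros (per y) (suc u) r + (bit (not b) + zeros (per y) (suc A) k)) out ⟩
        zeros (per y) (suc u) r + suc (zeros (per y) (suc A) k)
          ≡⟨ +-suc _ _ ⟩
        suc (zeros (per y) (suc u) r) + zeros (per y) (suc A) k
          ≤⟨ +-mono-≤ (positive r 0<r (≤-trans (m≤m+n r k) (≤-trans (n≤1+n _) (<⇒≤ ℓ<n))) (≤-reflexive u+r))
                      (opn (≤-<-trans (m≤n+m k r) (<-trans (n<1+n _) ℓ<n))) ⟩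
        ones (per y) (suc u) r + ones (per y) (suc A) k
          ≡⟨ cong (λ b → ones (per y) (suc u) r + (bit b + ones (per y) (suc A) k)) (sym out) ⟩
        ones (per y) (suc u) r + (bit (per y A) + ones (per y) (suc A) k) ∎)
      where
      open ≤-Reasoning
      0<r : 0 < r
      0<r = +-cancelˡ-< (suc u) 0 r (subst₂ _<_ (sym (+-identityʳ (suc u))) (sym u+r) u<A)
      split : ∀ s → ones s (suc u) (suc (r + k)) ≡ ones s (suc u) r + ones s A (suc k)
      split s = trans (cong (ones s (suc u)) (sym (+-suc r k)))
        (trans (ones-+ s (suc u) r (suc k)) (cong (λ j → ones s (suc u) r + ones s j (suc k)) u+r))

open Reach

-- The first `Opn` index lies outside `y`. Otherwise it would be free in `y`: for distance 0 this is
-- `t`, which is not free, and for a positive distance the index before it would be `Opn` as well.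
reach : ∀ {n} (y : Subset (suc n)) → InQ y → ∀ t → t < suc n → free (per y) (suc n) t ≡ false → ∃ λ d → Reach y t d
reach {n} y y∈Q t t<n ft with opn-within y y∈Q t t<n
... | d₀ , d₀< , op₀ with least {λ e → Opn (per y) (suc n) (t + e)} (λ e → opn? (per y) (suc n) (t + e)) d₀ op₀
... | d , d≤ , op , below = d , record { d<n = ≤-<-trans d≤ d₀< ; opn = op ; first = below ; out = ¬-not (not-one d op below) }
  where
  not-one : ∀ d → Opn (per y) (suc n) (t + d) → (∀ e → e < d → ¬ Opn (per y) (suc n) (t + e)) → per y (t + d) ≢ true
  not-one zero op _ yt with () ← trans (sym ft) (pos⇒free {per y} (s≤s z≤n)
    (subst (Pos (per y) (suc n)) (+-identityʳ t) (pos {per y} yt op)))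
  not-one (suc e) op below yA = below e (n<1+n e) opn-e
    where
    P : Pos (per y) (suc n) (suc (t + e))
    P = subst (Pos (per y) (suc n)) (+-suc t e) (pos {per y} yA op)
    opn-e : Opn (per y) (suc n) (t + e)
    opn-e {zero}  _   = z≤n
    opn-e {suc ℓ} ℓ<n = <⇒≤ (P (suc ℓ) (s≤s z≤n) (<⇒≤ ℓ<n))

-- A token (y , t) with t not free in y is carried to the cover of y at the first Opn point from t on.
-- It keeps its place there, except that the one place that has become free is charged to the added
-- element itself.
Token : ℕ → Set
Token n = Subset n × (ℕ × Bool)

data Moves : ∀ {n} → Subset n → ℕ → Token n → Set where
  stay : ∀ {n} {y : Subset (suc n)} {t d x} (R : Reach y t d) → x ≡ cover R →
    (Pos (per x) (suc n) t → d ≡ 0) → Moves y t (x , t , false)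
  jump : ∀ {n} {y : Subset (suc n)} {t d x q} (R : Reach y t d) → x ≡ cover R → Pos (per x) (suc n) t → 0 < d → q ≡ (t + d) % suc n → Moves y t (x , q , true)

update-injective : ∀ {n} (y y′ : Subset n) a b → lookup y a ≡ lookup y′ a → y [ a ]≔ b ≡ y′ [ a ]≔ b → y ≡ y′
update-injective (_ ∷ y) (_ ∷ y′) zero    b refl eq = cong (_ ∷_) (cong tail eq)
update-injective (c ∷ y) (c′ ∷ y′) (suc a) b la eq = cong₂ _∷_ (cong head eq) (update-injective y y′ a b la (cong tail eq))

cover-injective : ∀ {n} {y y′ : Subset (suc n)} {t t′ d d′} (R : Reach y t d) (R′ : Reach y′ t′ d′) →
  cover R ≡ cover R′ → (t + d) % suc n ≡ (t′ + d′) % suc n → y ≡ y′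
cover-injective {n} {y} {y′} {t} {t′} {d} {d′} R R′ eq mods = update-injective y y′ (target R) true
  (trans (out R) (trans (sym (out R′)) (cong (lookup y′) (sym targets))))
  (trans eq (cong (λ a → y′ [ a ]≔ true) (sym targets)))
  where
  targets : target R ≡ target R′
  targets = toℕ-injective (trans (toℕ-mod (t + d) (suc n)) (trans mods (sym (toℕ-mod (t′ + d′) (suc n)))))

-- The end of `R` is free in the common cover. For `d > 0` it would lie strictly between `t` and the
-- end of `R′`; for `d = 0` it is `t` itself, and the side condition of `stay` gives `d′ = 0`.
stay-d : ∀ {n} {y y′ : Subset (suc n)} {t d d′} (R : Reach y t d) (R′ : Reach y′ t d′) → cover R ≡ cover R′ →
  (Pos (per (cover R)) (suc n) t → d′ ≡ 0) → ¬ (d < d′)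
stay-d {n} {t = t} {zero}  R R′ eq h d<d′ with refl ← h (subst (Pos _ (suc n)) (+-identityʳ t) (pos-end R)) with () ← d<d′
stay-d {n} {t = t} {suc d} R R′ eq h d<d′ = no-pos-between R′ (m<m+n t (s≤s z≤n)) (+-monoʳ-< t d<d′)
  (subst (λ x → Pos (per x) (suc n) (t + suc d)) eq (pos-end R))

-- The ends are congruent and the second is less than two periods beyond the first, so they would
-- differ by exactly one period. Then the copy of the free place `t` in the next period lies
-- strictly between `t′` and the end of `R′`.
jump-wrap : ∀ {n} {y : Subset (suc n)} {t t′ d d′} (R : Reach y t d) (R′ : Reach y t′ d′) → cover R ≡ cover R′ →
  t < suc n → t′ < suc n → 0 < d → Pos (per (cover R)) (suc n) t → (t + d) % suc n ≡ (t′ + d′) % suc n → ¬ (t + d < t′ + d′)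
jump-wrap {n} {y} {t} {t′} {d} {d′} R R′ eq t<n t′<n 0<d P mods A<A′ with t′ + d′ <? (t + d) + suc n
... | yes near = mod-apart A<A′ near (sym mods)
... | no far with m≤n⇒m<n∨m≡n (≮⇒≥ far)
... | inj₁ beyond = mod-apart beyond
        (<-≤-trans (+-mono-< t′<n (d<n R′)) (+-monoˡ-≤ (suc n) (m≤n+m (suc n) (t + d))))
        (trans (sym mods) (sym ([m+n]%n≡m%n (t + d) (suc n))))
... | inj₂ A+n≡A′ = no-pos-between R′ {t + suc n}
        (<-≤-trans t′<n (m≤n+m (suc n) t))
        (subst (t + suc n <_) A+n≡A′ (+-monoˡ-< (suc n) (m<m+n t 0<d)))
        (subst (λ x → Pos (per x) (suc n) (t + suc n)) eq (pos-mod (cover R) (sym ([m+n]%n≡m%n t (suc n))) P))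

-- Otherwise the free place `t′` would lie strictly between `t` and the common end.
jump-t : ∀ {n} {y : Subset (suc n)} {t t′ d d′} (R : Reach y t d) (R′ : Reach y t′ d′) → cover R ≡ cover R′ →
  0 < d′ → Pos (per (cover R′)) (suc n) t′ → t + d ≡ t′ + d′ → ¬ (t < t′)
jump-t {n} {t′ = t′} {d′ = d′} R R′ eq 0<d′ P A≡A′ t<t′ = no-pos-between R {t′} t<t′
  (subst (t′ <_) (sym A≡A′) (m<m+n t′ 0<d′)) (subst (λ x → Pos (per x) (suc n) t′) (sym eq) P)

≮∧≯⇒≡ : ∀ {a b} → ¬ (a < b) → ¬ (b < a) → a ≡ b
≮∧≯⇒≡ p q = ≤-antisym (≮⇒≥ q) (≮⇒≥ p)

-- The token can be read off from its slot. A token that stayed at `t` has distance 0 exactly when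
-- `t` is free in the cover, and otherwise went to the next free element. For a token that jumped,
-- the slot names the added element, and `t` is the free element cyclically preceding it. Deleting
-- the added element recovers `y`.
moves-injective : ∀ {n} {y y′ : Subset n} {t t′ w} → t < n → t′ < n →
  Moves y t w → Moves y′ t′ w → (y , t) ≡ (y′ , t′)
moves-injective {suc n} {t = t} t<n _ (stay R refl h) (stay R′ eq h′) = cong (_, t)
  (cover-injective R R′ eq (cong (λ d → (t + d) % suc n) (≮∧≯⇒≡
    (stay-d R R′ eq h′)
    (stay-d R′ R (sym eq) (λ P → h (subst (λ x → Pos (per x) (suc n) t) (sym eq) P))))))
moves-injective {suc n} {t = t} {t′} t<n t′<n (jump {d = d} R refl P 0<d refl) (jump {d = d′} R′ eq P′ 0<d′ mods)
  with cover-injective R R′ eq mods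
... | refl = cong (_ ,_) (≮∧≯⇒≡ (jump-t R R′ eq 0<d′ P″ ends) (jump-t R′ R (sym eq) 0<d P (sym ends)))
  where
  P″ : Pos (per (cover R′)) (suc n) t′
  P″ = subst (λ x → Pos (per x) (suc n) t′) eq P′
  ends : t + d ≡ t′ + d′
  ends = ≮∧≯⇒≡ (jump-wrap R R′ eq t<n t′<n 0<d P mods)
    (jump-wrap R′ R (sym eq) t′<n t<n 0<d′ P″ (sym mods))

-- Counting with lists.

-- Pigeonhole principle for a relation: the partner of the head is deleted from `ys`, and
-- injectivity keeps it from being the partner of anything in the tail.
length-≤ : ∀ {A B : Set} (R : A → B → Set) {xs : List A} (ys : List B) → Unique xs →
  (∀ {x} → x ∈ˡ xs → ∃ λ y → y ∈ˡ ys × R x y) →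
  (∀ {x x′ y} → x ∈ˡ xs → x′ ∈ˡ xs → R x y → R x′ y → x ≡ x′) →
  length xs ≤ length ys
length-≤ R {L.[]} ys _ total inj = z≤n
length-≤ R {x L.∷ xs} ys (x∉xs ∷ uniq) total inj with total (here refl)
... | y , y∈ys , Rxy with ∈-∃++ y∈ys
... | as , bs , refl = ≤-trans
    (s≤s (length-≤ R (as L.++ bs) uniq total′ λ p q → inj (there p) (there q)))
    (≤-reflexive (sym (length-++-sucʳ as y bs)))
  where
  total′ : ∀ {x′} → x′ ∈ˡ xs → ∃ λ y′ → y′ ∈ˡ (as L.++ bs) × R x′ y′
  total′ {x′} x′∈ with total (there x′∈)
  ... | y′ , y′∈ , Rx′ with ∈-++⁻ as y′∈
  ... | inj₁ in-as         = y′ , ∈-++⁺ˡ in-as , Rx′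
  ... | inj₂ (there in-bs) = y′ , ∈-++⁺ʳ as in-bs , Rx′
  ... | inj₂ (here refl)   = ⊥-elim (All.lookup x∉xs x′∈ (inj (here refl) (there x′∈) Rxy Rx′))

∧-split : ∀ {a b} → a ∧ b ≡ true → a ≡ true × b ≡ true
∧-split {true} eq = refl , eq

length-filter-map : ∀ {A B : Set} (P : B → Bool) (f : A → B) xs →
  length (filterᵇ P (L.map f xs)) ≡ length (filterᵇ (P ∘ f) xs)
length-filter-map P f L.[] = refl
length-filter-map P f (x L.∷ xs) with P (f x)
... | true  = cong suc (length-filter-map P f xs)
... | false = length-filter-map P f xs

length-filter-++ : ∀ {A : Set} (P : A → Bool) xs ys →
  length (filterᵇ P (xs L.++ ys)) ≡ length (filterᵇ P xs) + length (filterᵇ P ys)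
length-filter-++ P xs ys = trans (cong length (filter-++ (T? ∘ P) xs ys)) (length-++ (filterᵇ P xs))

length-filter-mono : ∀ {A : Set} {P Q : A → Bool} → (∀ x → P x ≡ true → Q x ≡ true) → ∀ xs →
  length (filterᵇ P xs) ≤ length (filterᵇ Q xs)
length-filter-mono h L.[] = z≤n
length-filter-mono {P = P} {Q} h (x L.∷ xs) with P x in Px | Q x in Qx
... | true  | true  = s≤s (length-filter-mono h xs)
... | false | true  = m≤n⇒m≤1+n (length-filter-mono h xs)
... | false | false = length-filter-mono h xs
... | true  | false with () ← trans (sym (h x Px)) Qx

length-filter-cong : ∀ {A : Set} {P Q : A → Bool} → (∀ x → P x ≡ Q x) → ∀ xs →
  length (filterᵇ P xs) ≡ length (filterᵇ Q xs)
length-filter-cong h xs = ≤-antisym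
  (length-filter-mono (λ x e → trans (sym (h x)) e) xs) (length-filter-mono (λ x e → trans (h x) e) xs)

length-filter-split : ∀ {A : Set} (P Q : A → Bool) → (∀ x → Q x ≡ true → P x ≡ true) → ∀ xs →
  length (filterᵇ Q xs) + length (filterᵇ (λ x → P x ∧ not (Q x)) xs) ≡ length (filterᵇ P xs)
length-filter-split P Q h L.[] = refl
length-filter-split P Q h (x L.∷ xs) with P x in Px | Q x in Qx
... | true  | true  = cong suc (length-filter-split P Q h xs)
... | true  | false = trans (+-suc _ _) (cong suc (length-filter-split P Q h xs))
... | false | false = length-filter-split P Q h xs
... | false | true  with () ← trans (sym (h x Qx)) Px

length-filter-product : ∀ {A B : Set} (X : A → Bool) (P : A → B → Bool) k (ts : List B) →
  (∀ y → X y ≡ true → length (filterᵇ (P y) ts) ≡ k) → ∀ xs →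
  length (filterᵇ (λ (y , t) → X y ∧ P y t) (cartesianProduct xs ts)) ≡ length (filterᵇ X xs) * k
length-filter-product X P k ts h L.[] = refl
length-filter-product X P k ts h (y L.∷ xs) = begin
  length (filterᵇ XP (L.map (y ,_) ts L.++ cartesianProduct xs ts))
    ≡⟨ length-filter-++ XP (L.map (y ,_) ts) _ ⟩
  length (filterᵇ XP (L.map (y ,_) ts)) + length (filterᵇ XP (cartesianProduct xs ts))
    ≡⟨ cong₂ _+_ (length-filter-map XP (y ,_) ts) (length-filter-product X P k ts h xs) ⟩
  length (filterᵇ (λ t → X y ∧ P y t) ts) + length (filterᵇ X xs) * k
    ≡⟨ row (X y) refl ⟩
  length (filterᵇ X (y L.∷ xs)) * k ∎
  where
  open ≡-Reasoning
  XP = λ (y , t) → X y ∧ P y t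
  none : ∀ ts → length (filterᵇ (λ _ → false) ts) ≡ 0
  none L.[] = refl
  none (_ L.∷ ts) = none ts
  row : ∀ b → X y ≡ b → length (filterᵇ (λ t → X y ∧ P y t) ts) + length (filterᵇ X xs) * k ≡ length (filterᵇ X (y L.∷ xs)) * k
  row true  eq rewrite eq = cong (_+ length (filterᵇ X xs) * k) (h y eq)
  row false eq rewrite eq = cong (_+ length (filterᵇ X xs) * k) (none ts)

length-filter-upTo : ∀ (s : Seq) (f : ℕ → ℕ) i n → (∀ r → f r ≡ i + r) → length (filterᵇ s (applyUpTo f n)) ≡ ones s i n
length-filter-upTo s f i zero    eq = refl
length-filter-upTo s f i (suc n) eq rewrite trans (eq 0) (+-identityʳ i) with s i
... | true  = cong suc (length-filter-upTo s (f ∘ suc) (suc i) n λ r → trans (eq (suc r)) (+-suc i r))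
... | false = length-filter-upTo s (f ∘ suc) (suc i) n λ r → trans (eq (suc r)) (+-suc i r)

-- Levels and neighbourhoods.

level-size : ∀ {n} {k} {x : Subset n} → level k x ≡ true → ∣ x ∣ ≡ k
level-size {k = k} {x} eq with ∣ x ∣ ≟ k
... | yes p = p

size-level : ∀ {n} {k} {x : Subset n} → ∣ x ∣ ≡ k → level k x ≡ true
size-level {k = k} {x} eq with ∣ x ∣ ≟ k
... | yes p = refl
... | no ¬p = ⊥-elim (¬p eq)

comparable⇒ : ∀ {n} (x y : Subset n) → comparableᵇ x y ≡ true → x ≺ y ⊎ y ≺ x
comparable⇒ x y eq with x ≺? y | y ≺? x
... | yes p | _     = inj₁ p
... | no _  | yes q = inj₂ q

⇒comparable : ∀ {n} (x y : Subset n) → x ≺ y ⊎ y ≺ x → comparableᵇ x y ≡ true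
⇒comparable x y h with x ≺? y | y ≺? x
... | yes p | _     = refl
... | no _  | yes q = refl
⇒comparable x y (inj₁ p) | no ¬p | no _  = ⊥-elim (¬p p)
⇒comparable x y (inj₂ q) | no _  | no ¬q = ⊥-elim (¬q q)

∈-Γ⁻ : ∀ {n} (X : Subset n → Bool) l {y} → Γ X l y ≡ true →
  ∣ y ∣ ≡ l × ∃ λ x → X x ≡ true × (x ≺ y ⊎ y ≺ x)
∈-Γ⁻ {n} X l {y} eq with ∧-split {level l y} eq
... | ly , some with satisfied (any⁻ (λ x → X x ∧ comparableᵇ x y) (allSubsets n) (≡⇒T some))
... | x , both with ∧-split {X x} (T⇒≡ both)
... | Xx , cmp = level-size {x = y} ly , x , Xx , comparable⇒ x y cmp

∈-Γ⁺ : ∀ {n} (X : Subset n → Bool) l {x y} → ∣ y ∣ ≡ l → X x ≡ true → x ≺ y ⊎ y ≺ x → Γ X l y ≡ true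
∈-Γ⁺ {n} X l {x} {y} ly Xx cmp = cong₂ _∧_ (size-level {x = y} ly)
  (T⇒≡ (any⁺ (λ x → X x ∧ comparableᵇ x y) (lose (∈-allSubsets x) (≡⇒T (cong₂ _∧_ Xx (⇒comparable x y cmp))))))

unique-allSubsets : ∀ n → Unique (allSubsets n)
unique-allSubsets zero    = All.[] ∷ []
unique-allSubsets (suc n) = ++⁺ (map⁺ tails (unique-allSubsets n)) (map⁺ tails (unique-allSubsets n))
  λ (p , q) → heads (∈-map⁻ (false ∷_) p) (∈-map⁻ (true ∷_) q)
  where
  tails : ∀ {b} {x y : Subset n} → b ∷ x ≡ b ∷ y → x ≡ y
  tails refl = refl
  heads : ∀ {v : Subset (suc n)} → ∃ (λ x → x ∈ˡ allSubsets n × v ≡ false ∷ x) → ∃ (λ x → x ∈ˡ allSubsets n × v ≡ true ∷ x) → ⊥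
  heads (_ , _ , refl) (_ , _ , ())

level⇒InQ : ∀ {n k} {x : Subset n} → ⌈ n /2⌉ ≤ k → ∣ x ∣ ≡ k → InQ x
level⇒InQ {n} {k} {x} h refl = begin
  n                      ≡⟨ sym (⌊n/2⌋+⌈n/2⌉≡n n) ⟩
  ⌊ n /2⌋ + ⌈ n /2⌉      ≤⟨ +-mono-≤ (≤-trans (⌊n/2⌋≤⌈n/2⌉ n) h) h ⟩
  ∣ x ∣ + ∣ x ∣          ≡⟨ cong (∣ x ∣ +_) (sym (+-identityʳ ∣ x ∣)) ⟩
  2 * ∣ x ∣              ∎
  where open ≤-Reasoning

-- Numbers of tokens and slots, and the bound between adjacent levels.

unfree-count : ∀ {n} (y : Subset n) → InQ y → zeros (free (per y) n) 0 n ≡ (n ∸ ∣ y ∣) + (n ∸ ∣ y ∣)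
unfree-count {n} y y∈Q = +-cancelˡ-≡ (ones u 0 n) _ _ (begin
  ones u 0 n + zeros u 0 n   ≡⟨ ones+zeros u 0 n ⟩
  n                          ≡⟨ sym total ⟩
  r + ∣ y ∣                  ≡⟨ cong (r +_) (sym zf) ⟩
  r + (r + ones u 0 n)       ≡⟨ rg r (ones u 0 n) ⟩
  ones u 0 n + (r + r)       ∎)
  where
  open ≡-Reasoning
  u = free (per y) n
  r = n ∸ ∣ y ∣
  total : r + ∣ y ∣ ≡ n
  total = m∸n+n≡m (≤-trans (≤-reflexive (∣∣-ones y)) (≤-trans (m≤m+n _ _) (≤-reflexive (ones+zeros (per y) 0 n))))
  zs : zeros (per y) 0 n ≡ r
  zs = +-cancelʳ-≡ ∣ y ∣ _ _ (begin
    zeros (per y) 0 n + ∣ y ∣              ≡⟨ +-comm _ ∣ y ∣ ⟩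
    ∣ y ∣ + zeros (per y) 0 n              ≡⟨ cong (_+ zeros (per y) 0 n) (∣∣-ones y) ⟩
    ones (per y) 0 n + zeros (per y) 0 n   ≡⟨ ones+zeros (per y) 0 n ⟩
    n                                      ≡⟨ sym total ⟩
    r + ∣ y ∣                              ∎)
  zf : r + ones u 0 n ≡ ∣ y ∣
  zf = trans (cong (_+ ones u 0 n) (sym zs)) (CoreFacts.zeros+free y y∈Q)
  rg : ∀ a b → a + (a + b) ≡ b + (a + a)
  rg = solve-∀

n+free-count : ∀ {n} (x : Subset n) → InQ x → n + ones (free (per x) n) 0 n ≡ ∣ x ∣ + ∣ x ∣
n+free-count {n} x x∈Q = begin
  n + ones u 0 n                                        ≡⟨ cong (_+ ones u 0 n) (sym (ones+zeros (per x) 0 n)) ⟩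
  (ones (per x) 0 n + zeros (per x) 0 n) + ones u 0 n   ≡⟨ +-assoc (ones (per x) 0 n) _ _ ⟩
  ones (per x) 0 n + (zeros (per x) 0 n + ones u 0 n)   ≡⟨ cong₂ _+_ (sym (∣∣-ones x)) (CoreFacts.zeros+free x x∈Q) ⟩
  ∣ x ∣ + ∣ x ∣                                         ∎
  where
  open ≡-Reasoning
  u = free (per x) n

place : ∀ {n} → Subset n → ℕ × Bool → Bool
place {n} x (q , b) = not b ∨ free (per x) n q

places : ℕ → List (ℕ × Bool)
places n = cartesianProduct (upTo n) (false L.∷ true L.∷ L.[])

length-places : ∀ {n} (x : Subset n) → InQ x → length (filterᵇ (place x) (places n)) ≡ ∣ x ∣ + ∣ x ∣
length-places {n} x x∈Q = trans (go (upTo n)) (trans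
  (cong₂ _+_ (length-upTo n) (length-filter-upTo (free (per x) n) (λ i → i) 0 n λ _ → refl)) (n+free-count x x∈Q))
  where
  go : ∀ qs → length (filterᵇ (place x) (cartesianProduct qs (false L.∷ true L.∷ L.[]))) ≡ length qs + length (filterᵇ (free (per x) n) qs)
  go L.[] = refl
  go (q L.∷ qs) with free (per x) n q
  ... | true  = cong suc (trans (cong suc (go qs)) (sym (+-suc _ _)))
  ... | false = cong suc (go qs)

double-cancel : ∀ a b c d → a * (b + b) ≤ c * (d + d) → a * b ≤ c * d
double-cancel a b c d le = *-cancelˡ-≤ 2 (subst₂ _≤_ (rg a b) (rg c d) le)
  where
  rg : ∀ a b → a * (b + b) ≡ 2 * (a * b)
  rg = solve-∀


-- Double counting through an injection: each member of `X` sends out `j` tokens, each member of `Y`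
-- offers `k` slots, and `R` assigns slots without collisions.
transport-count : ∀ {A B C : Set} (xs : List A) (ts : List B) (ws : List C)
  (X : A → Bool) (P : A → B → Bool) (j : ℕ) (Y : A → Bool) (Q : A → C → Bool) (k : ℕ) (R : A → B → A × C → Set) →
  Unique xs → Unique ts →
  (∀ y → X y ≡ true → length (filterᵇ (P y) ts) ≡ j) →
  (∀ x → Y x ≡ true → length (filterᵇ (Q x) ws) ≡ k) →
  (∀ {y t} → X y ≡ true → t ∈ˡ ts → P y t ≡ true →
    ∃ λ x → ∃ λ w → x ∈ˡ xs × w ∈ˡ ws × Y x ≡ true × Q x w ≡ true × R y t (x , w)) →
  (∀ {y y′ t t′ v} → t ∈ˡ ts → t′ ∈ˡ ts → R y t v → R y′ t′ v → (y , t) ≡ (y′ , t′)) →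
  length (filterᵇ X xs) * j ≤ length (filterᵇ Y xs) * k
transport-count xs ts ws X P j Y Q k R uxs uts Pj Qk total inj = subst₂ _≤_
  (length-filter-product X P j ts Pj xs) (length-filter-product Y Q k ws Qk xs)
  (length-≤ (λ (y , t) → R y t) (filterᵇ tgtᵇ (cartesianProduct xs ws)) (filter⁺ (T? ∘ srcᵇ) (cartesianProduct⁺ uxs uts))
    total′ λ p q → inj (proj₁ (proj₂ (in-src p))) (proj₁ (proj₂ (in-src q))))
  where
  srcᵇ = λ (y , t) → X y ∧ P y t
  tgtᵇ = λ (x , w) → Y x ∧ Q x w
  in-src : ∀ {v} → v ∈ˡ filterᵇ srcᵇ (cartesianProduct xs ts) → X (proj₁ v) ≡ true × proj₂ v ∈ˡ ts × P (proj₁ v) (proj₂ v) ≡ true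
  in-src {y , t} p with ∈-filter⁻ (T? ∘ srcᵇ) {xs = cartesianProduct xs ts} p
  ... | q , s with ∧-split {X y} (T⇒≡ s)
  ... | Xy , Py = Xy , proj₂ (∈-cartesianProduct⁻ xs ts q) , Py
  total′ : ∀ {v} → v ∈ˡ filterᵇ srcᵇ (cartesianProduct xs ts) →
    ∃ λ w → w ∈ˡ filterᵇ tgtᵇ (cartesianProduct xs ws) × R (proj₁ v) (proj₂ v) w
  total′ p with in-src p
  ... | Xy , t∈ , Py with total Xy t∈ Py
  ... | x , w , x∈ , w∈ , Yx , Qw , r = (x , w) ,
        ∈-filter⁺ (T? ∘ tgtᵇ) (∈-cartesianProduct⁺ x∈ w∈) (≡⇒T (cong₂ _∧_ Yx Qw)) , r

bool∈ : ∀ b → b ∈ˡ (false L.∷ true L.∷ L.[])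
bool∈ false = here refl
bool∈ true  = there (here refl)

∈-places : ∀ {n q} b → q < n → (q , b) ∈ˡ places n
∈-places b q<n = ∈-cartesianProduct⁺ (∈-upTo⁺ q<n) (bool∈ b)

record Move {n} (y : Subset n) (t : ℕ) : Set where
  field
    added : Fin n
    spot  : ℕ × Bool
  result : Subset n
  result = y [ added ]≔ true
  field
    is-new   : lookup y added ≡ false
    is-free  : free (per result) n (toℕ added) ≡ true
    in-range : spot ∈ˡ places n
    is-place : place result spot ≡ true
    is-move  : Moves y t (result , spot)

move-along : ∀ {n} (y : Subset (suc n)) t → t < suc n → ∀ d (R : Reach y t d) → Dec (d ≡ 0) →
  ∀ b → free (per (Reach.cover R)) (suc n) t ≡ b → Move y t
move-along {n} y t t<n d R = settle
  where
  x = Reach.cover R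
  fa : free (per x) (suc n) (toℕ (Reach.target R)) ≡ true
  fa = free-add y (t + d) (Reach.opn R)
  stays : (Pos (per x) (suc n) t → d ≡ 0) → Move y t
  stays h = record
    { added = Reach.target R ; spot = t , false ; is-new = Reach.out R ; is-free = fa
    ; in-range = ∈-places false t<n ; is-place = refl ; is-move = stay R refl h }
  settle : Dec (d ≡ 0) → ∀ b → free (per x) (suc n) t ≡ b → Move y t
  settle (yes d≡0) _ _ = stays λ _ → d≡0
  -- `t` is not free in the cover, so the side condition of `stay` holds vacuously.
  settle (no d≢0) false ft = stays λ P → contradiction (trans (sym (pos⇒free {per x} (s≤s z≤n) P)) ft) λ ()
  settle (no d≢0) true ft = record
    { added = Reach.target R ; spot = (t + d) % suc n , true ; is-new = Reach.out R ; is-free = fa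
    ; in-range = ∈-places true (m%n<n (t + d) (suc n))
    ; is-place = subst (λ q → free (per x) (suc n) q ≡ true) (toℕ-mod (t + d) (suc n)) fa
    ; is-move = jump R refl (free⇒pos {per x} ft) (n≢0⇒n>0 d≢0) refl }

move : ∀ {n} (y : Subset n) → InQ y → ∀ t → t < n → free (per y) n t ≡ false → Move y t
move {suc n} y y∈Q t t<n nf = along (reach y y∈Q t t<n nf)
  where
  along : (∃ λ d → Reach y t d) → Move y t
  along (d , R) = move-along y t t<n d R (d ≟ 0) _ refl

push-up : ∀ n k → ⌈ n /2⌉ ≤ k → (X : Subset n → Bool) → (∀ x → X x ≡ true → ∣ x ∣ ≡ k) →
  count X * (n ∸ k) ≤ count (Γ X (suc k)) * suc k
push-up n k h X Xk = double-cancel (count X) _ (count ΓX) _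
  (transport-count (allSubsets n) (upTo n) (places n) X unfree _ ΓX place _ Moves
    (unique-allSubsets n) (upTo⁺ n) unfree-length place-length
    (λ {y} {t} Xy t∈ nf → carry y t Xy (∈-upTo⁻ t∈) (not-true nf))
    (λ t∈ t′∈ → moves-injective (∈-upTo⁻ t∈) (∈-upTo⁻ t′∈)))
  where
  ΓX = Γ X (suc k)
  unfree : Subset n → ℕ → Bool
  unfree y t = not (free (per y) n t)
  inQ : ∀ y → X y ≡ true → InQ y
  inQ y Xy = level⇒InQ {x = y} h (Xk y Xy)
  unfree-length : ∀ y → X y ≡ true → length (filterᵇ (unfree y) (upTo n)) ≡ n ∸ k + (n ∸ k)
  unfree-length y Xy = trans (length-filter-upTo (unfree y) (λ i → i) 0 n λ _ → refl)
    (trans (unfree-count y (inQ y Xy)) (cong (λ j → n ∸ j + (n ∸ j)) (Xk y Xy)))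
  place-length : ∀ x → ΓX x ≡ true → length (filterᵇ (place x) (places n)) ≡ suc k + suc k
  place-length x Γx with proj₁ (∈-Γ⁻ X (suc k) {x} Γx)
  ... | size = trans (length-places x (level⇒InQ {x = x} (m≤n⇒m≤1+n h) size)) (cong (λ j → j + j) size)
  carry : ∀ y t → X y ≡ true → t < n → free (per y) n t ≡ false →
    ∃ λ x → ∃ λ w → x ∈ˡ allSubsets n × w ∈ˡ places n × ΓX x ≡ true × place x w ≡ true × Moves y t (x , w)
  carry y t Xy t<n nf = result , spot , ∈-allSubsets result , in-range ,
    ∈-Γ⁺ X (suc k) {y} {result} (trans (∣add∣ y added is-new) (cong suc (Xk y Xy))) Xy
      (inj₁ (≺-add y added (inQ y Xy) is-new is-free)) , is-place , is-move
    where open Move (move y (inQ y Xy) t t<n nf)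

-- Level sizes as binomial coefficients.

count-∷ : ∀ {n} (X : Subset (suc n) → Bool) → count X ≡ count (X ∘ (false ∷_)) + count (X ∘ (true ∷_))
count-∷ {n} X = trans (length-filter-++ X (L.map (false ∷_) (allSubsets n)) _)
  (cong₂ _+_ (length-filter-map X (false ∷_) (allSubsets n)) (length-filter-map X (true ∷_) (allSubsets n)))

-- Kept as the level count that occurs in the matching inequality; the arithmetic is derived from
-- Pascal's rule.
binomial : ℕ → ℕ → ℕ
binomial n k = count (level {n} k)

binomial-suc : ∀ n k → binomial (suc n) (suc k) ≡ binomial n (suc k) + binomial n k
binomial-suc n k = trans (count-∷ {n} (level (suc k)))
  (cong (count {n} (level (suc k)) +_) (length-filter-cong shift (allSubsets n)))
  where
  shift : ∀ (x : Subset n) → level (suc k) (true ∷ x) ≡ level k x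
  shift x with suc ∣ x ∣ ≟ suc k | ∣ x ∣ ≟ k
  ... | yes _ | yes _ = refl
  ... | no _  | no _  = refl
  ... | yes p | no ¬q = ⊥-elim (¬q (suc-injective p))
  ... | no ¬p | yes q = ⊥-elim (¬p (cong suc q))

binomial-zero : ∀ n → binomial (suc n) 0 ≡ binomial n 0
binomial-zero n = trans (count-∷ {n} (level 0)) (trans (cong (count {n} (level 0) +_) (none (allSubsets n))) (+-identityʳ _))
  where
  none : ∀ xs → length (filterᵇ (λ x → level 0 (true ∷ x)) xs) ≡ 0
  none L.[] = refl
  none (x L.∷ xs) = none xs

binomial-positive : ∀ n k → k ≤ n → 0 < binomial n k
binomial-positive zero    zero    _         = s≤s z≤n
binomial-positive (suc n) zero    _         = subst (0 <_) (sym (binomial-zero n)) (binomial-positive n 0 z≤n)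
binomial-positive (suc n) (suc k) (s≤s k≤n) = subst (0 <_) (sym (binomial-suc n k))
  (<-≤-trans (binomial-positive n k k≤n) (m≤n+m _ _))

-- The identity (n - k) C(n,k) = (k + 1) C(n,k+1) with the subtraction moved across, so that it
-- holds for all `k` and follows from Pascal's rule by induction.
binomial-absorb : ∀ n k → binomial n k * n ≡ binomial n k * k + binomial n (suc k) * suc k
binomial-absorb zero    zero    = refl
binomial-absorb zero    (suc k) = refl
binomial-absorb (suc n) zero
  rewrite binomial-zero n | binomial-suc n 0 = begin
  a * suc n                                ≡⟨ *-suc a n ⟩
  a + a * n                                ≡⟨ cong (a +_) (binomial-absorb n 0) ⟩
  a + (a * 0 + binomial n 1 * 1)           ≡⟨ rg a (binomial n 1) ⟩
  a * 0 + (binomial n 1 + a) * 1           ∎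
  where
  open ≡-Reasoning
  a = binomial n 0
  rg : ∀ a b → a + (a * 0 + b * 1) ≡ a * 0 + (b + a) * 1
  rg = solve-∀
binomial-absorb (suc n) (suc k)
  rewrite binomial-suc n k | binomial-suc n (suc k) = begin
  (b + a) * suc n                                               ≡⟨ rg₁ a b n ⟩
  b * n + a * n + (b + a)                                       ≡⟨ cong₂ (λ p q → p + q + (b + a)) (binomial-absorb n (suc k)) (binomial-absorb n k) ⟩
  (b * suc k + e * suc (suc k)) + (a * k + b * suc k) + (b + a) ≡⟨ rg₂ a b e k ⟩
  (b + a) * suc k + (e + b) * suc (suc k)                       ∎
  where
  open ≡-Reasoning
  a = binomial n k
  b = binomial n (suc k)
  e = binomial n (suc (suc k))
  rg₁ : ∀ a b n → (b + a) * (1 + n) ≡ b * n + a * n + (b + a)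
  rg₁ = solve-∀
  rg₂ : ∀ a b c k → (b * (1 + k) + c * (2 + k)) + (a * k + b * (1 + k)) + (b + a) ≡ (b + a) * (1 + k) + (c + b) * (2 + k)
  rg₂ = solve-∀

binomial-ratio : ∀ n k → k ≤ n → binomial n k * (n ∸ k) ≡ binomial n (suc k) * suc k
binomial-ratio n k k≤n = +-cancelˡ-≡ (binomial n k * k) _ _ (begin
  binomial n k * k + binomial n k * (n ∸ k)        ≡⟨ sym (*-distribˡ-+ (binomial n k) k (n ∸ k)) ⟩
  binomial n k * (k + (n ∸ k))                     ≡⟨ cong (binomial n k *_) (m+[n∸m]≡n k≤n) ⟩
  binomial n k * n                                 ≡⟨ binomial-absorb n k ⟩
  binomial n k * k + binomial n (suc k) * suc k    ∎)
  where open ≡-Reasoning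

-- From adjacent levels to all pairs of levels.

-- The token bound weighs the two sides by `r` and `c`. The two full levels satisfy it with
-- equality, which lets their sizes replace these weights.
ratio-compose : ∀ {a b c x y} r → 0 < r → a * r ≡ b * c → x * r ≤ y * c → x * b ≤ y * a
ratio-compose {a} {b} {c} {x} {y} (suc r) _ eq le = *-cancelʳ-≤ _ _ (suc r) (begin
  x * b * suc r     ≡⟨ rg x b (suc r) ⟩
  (x * suc r) * b   ≤⟨ *-monoˡ-≤ b le ⟩
  (y * c) * b       ≡⟨ rg′ y c b ⟩
  y * (b * c)       ≡⟨ cong (y *_) (sym eq) ⟩
  y * (a * suc r)   ≡⟨ sym (*-assoc y a (suc r)) ⟩
  y * a * suc r     ∎)
  where
  open ≤-Reasoning
  rg : ∀ x b r → x * b * r ≡ (x * r) * b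
  rg = solve-∀
  rg′ : ∀ y c b → (y * c) * b ≡ y * (b * c)
  rg′ = solve-∀

Γ-⊆-level : ∀ {n} (X : Subset n → Bool) l y → Γ X l y ≡ true → ∣ y ∣ ≡ l
Γ-⊆-level X l y eq = proj₁ (∈-Γ⁻ X l {y} eq)

matching-adjacent : ∀ n k → ⌈ n /2⌉ ≤ k → k < n → (X : Subset n → Bool) → (∀ x → X x ≡ true → ∣ x ∣ ≡ k) →
  count X * binomial n (suc k) ≤ count (Γ X (suc k)) * binomial n k
matching-adjacent n k h k<n X Xk =
  ratio-compose {a = binomial n k} {b = binomial n (suc k)} {x = count X} {y = count (Γ X (suc k))} (n ∸ k) (m<n⇒0<n∸m k<n)
    (binomial-ratio n k (<⇒≤ k<n)) (push-up n k h X Xk)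

≺⇒∣∣≤ : ∀ {n} {y x : Subset n} → y ≺ x → ∣ y ∣ ≤ ∣ x ∣
≺⇒∣∣≤ (_ , _ , _ , y⊆x) = p⊆q⇒∣p∣≤∣q∣ y⊆x

upward : ∀ {n} {x y : Subset n} → ∣ x ∣ < ∣ y ∣ → x ≺ y ⊎ y ≺ x → x ≺ y
upward lt (inj₁ p) = p
upward lt (inj₂ q) = ⊥-elim (<-irrefl refl (<-≤-trans lt (≺⇒∣∣≤ q)))

-- The sizes fix the direction of both comparabilities, so they compose by transitivity.
Γ-Γ-⊆ : ∀ {n} (X : Subset n → Bool) {k l} → (∀ x → X x ≡ true → ∣ x ∣ ≡ k) → k < l →
  ∀ z → Γ (Γ X l) (suc l) z ≡ true → Γ X (suc l) z ≡ true
Γ-Γ-⊆ X {k} {l} Xk k<l z eq with ∈-Γ⁻ (Γ X l) (suc l) {z} eq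
... | zl , y , Γy , yz with ∈-Γ⁻ X l {y} Γy
... | yl , x , Xx , xy = ∈-Γ⁺ X (suc l) {x} {z} zl Xx (inj₁ (≺-trans
  (upward (subst₂ _<_ (sym (Xk x Xx)) (sym yl) k<l) xy) (upward (subst₂ _<_ (sym yl) (sym zl) ≤-refl) yz)))

chain-cancel : ∀ {x y z a b c} → 0 < b → x * b ≤ y * a → y * c ≤ z * b → x * c ≤ z * a
chain-cancel {x} {y} {z} {a} {suc b} {c} _ p q = *-cancelʳ-≤ _ _ (suc b) (begin
  x * c * suc b      ≡⟨ rg x c (suc b) ⟩
  x * suc b * c      ≤⟨ *-monoˡ-≤ c p ⟩
  y * a * c          ≡⟨ rg y a c ⟩
  y * c * a          ≤⟨ *-monoˡ-≤ a q ⟩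
  z * suc b * a      ≡⟨ rg z (suc b) a ⟩
  z * a * suc b      ∎)
  where
  open ≤-Reasoning
  rg : ∀ x c b → x * c * b ≡ x * b * c
  rg = solve-∀

matching-up : ∀ n k d → ⌈ n /2⌉ ≤ k → suc (k + d) ≤ n → (X : Subset n → Bool) → (∀ x → X x ≡ true → ∣ x ∣ ≡ k) →
  count X * binomial n (suc (k + d)) ≤ count (Γ X (suc (k + d))) * binomial n k
matching-up n k zero    h lt X Xk rewrite +-identityʳ k = matching-adjacent n k h lt X Xk
matching-up n k (suc d) h lt X Xk rewrite +-suc k d =
  -- The intermediate level is nonempty, so its size can be cancelled between the two bounds.
  chain-cancel {x = count X} {y = count Y} {z = count (Γ X (suc l))} (binomial-positive n l (<⇒≤ lt))
    (matching-up n k d h (<⇒≤ lt) X Xk)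
    (≤-trans (matching-adjacent n l (≤-trans h (m≤n⇒m≤1+n (m≤m+n k d))) lt Y (Γ-⊆-level X l))
      (*-monoˡ-≤ (binomial n l) (length-filter-mono (Γ-Γ-⊆ X Xk (s≤s (m≤m+n k d))) (allSubsets n))))
  where
  l = suc (k + d)
  Y = Γ X l

-- No element of X is comparable to an element of level l outside Γ(X).
matching-flip : ∀ n k l →
  (∀ (Y : Subset n → Bool) → (∀ y → Y y ≡ true → ∣ y ∣ ≡ l) →
    count Y * binomial n k ≤ count (Γ Y k) * binomial n l) →
  (X : Subset n → Bool) → (∀ x → X x ≡ true → ∣ x ∣ ≡ k) →
  count X * binomial n l ≤ count (Γ X l) * binomial n k
matching-flip n k l below X Xk = combine {count X} {count X′} {count Y} {count Y′}
  (length-filter-split (level k) X (λ x Xx → size-level {x = x} (Xk x Xx)) (allSubsets n))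
  (length-filter-split (level l) Y (λ y Yy → size-level {x = y} (Γ-⊆-level X l y Yy)) (allSubsets n))
  (≤-trans (below Y′ λ y Y′y → level-size {x = y} (proj₁ (∧-split {level l y} Y′y)))
    (*-monoˡ-≤ (binomial n l) (length-filter-mono ΓY′⊆X′ (allSubsets n))))
  where
  Y X′ Y′ : Subset n → Bool
  Y = Γ X l
  X′ x = level k x ∧ not (X x)
  Y′ y = level l y ∧ not (Y y)
  ΓY′⊆X′ : ∀ x → Γ Y′ k x ≡ true → X′ x ≡ true
  ΓY′⊆X′ x eq with ∈-Γ⁻ Y′ k {x} eq
  ... | xk , y , Y′y , yx with ∧-split {level l y} Y′y
  ... | yl , ¬Yy = cong₂ _∧_ (size-level {x = x} xk) (cong not (¬-not λ Xx → contradiction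
          (trans (sym (∈-Γ⁺ X l {x} {y} (level-size {x = y} yl) Xx (swap yx))) (not-true ¬Yy)) λ ()))
  combine : ∀ {x x′ y y′ a b} → x + x′ ≡ a → y + y′ ≡ b → y′ * a ≤ x′ * b → x * b ≤ y * a
  -- `x * b + x′ * b` and `y * a + y′ * a` both equal `a * b`, so passing to complements reverses
  -- the inequality.
  combine {x} {x′} {y} {y′} {a} {b} refl refl le = +-cancelʳ-≤ (y′ * a) _ _ (begin
    x * b + y′ * a     ≤⟨ +-monoʳ-≤ (x * b) le ⟩
    x * b + x′ * b     ≡⟨ rg x x′ y y′ ⟩
    y * a + y′ * a     ∎)
    where
    open ≤-Reasoning
    rg : ∀ x x′ y y′ → x * (y + y′) + x′ * (y + y′) ≡ y * (x + x′) + y′ * (x + x′)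
    rg = solve-∀

matching : ∀ n → IsNormalizedMatching n
matching n k l hk k≤n hl l≤n k≢l X Xk with ≤-total k l
... | inj₁ k≤l with m≤n⇒∃[o]m+o≡n (≤∧≢⇒< k≤l k≢l)
... | d , refl = matching-up n k d hk l≤n X Xk
matching n k l hk k≤n hl l≤n k≢l X Xk | inj₂ l≤k with m≤n⇒∃[o]m+o≡n (≤∧≢⇒< l≤k (k≢l ∘ sym))
... | d , refl = matching-flip n k l (matching-up n l d hl k≤n) X Xk

theorem2p2 : ∀ (n : ℕ) → IsGradedWithSizeLevels n × IsNormalizedMatching n
theorem2p2 n = graded n , matching n
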